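{- As $n\to\infty$, the expected number of steps of a grand zigzag knight's path of size $2n$ ending on the $x$-axis, chosen uniformly at random among all such paths, is asymptotically equivalent to $$\frac{1+\sqrt5}{2\sqrt5}\cdot 2n.$$ This expected number of steps is also equal to the expected (total) number of parts of a pair $(X,Y)$ chosen uniformly at random among all pairs of compositions of $n$ with parts in $\{1,2\}$ and having the same number of parts.
   Context: A grand zigzag knight's path is a lattice path in $\mathbb{Z}^2$ starting at the origin, made of steps $N=(1,2)$, $\bar N=(1,-2)$, $E=(2,1)$, $\bar E=(2,-1)$, such that the vertical components of two consecutive steps never have the same direction (up-steps $N,E$ and down-steps $\bar N,\bar E$ alternate). The size is the $x$-coordinate of the last point. A composition of $n$ is a finite sequence of positive integers with sum $n$; the number of parts of a pair $(X,Y)$ is the number of parts of $X$ plus the number of parts of $Y$. -}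

module Defs where

open import Level using (0ℓ)
open import Data.Nat as ℕ using (ℕ; zero; suc; z≤n; s≤s)
import Data.Nat.Properties as ℕP
open import Data.Integer as ℤ using (ℤ; +_; -[1+_]; 0ℤ)
import Data.Integer.Properties as ℤP
open import Data.Rational as ℚ using (ℚ; 0ℚ; 1ℚ)
import Data.Rational.Properties as ℚP
import Data.Sign.Properties as SignP
open import Data.Product using (Σ; ∃; ∃-syntax; _×_; _,_; proj₁; proj₂; uncurry)
import Data.Product.Properties as ProdP
open import Data.Sum using (_⊎_; inj₁; inj₂)
open import Data.List using (List; []; _∷_; length; map; filter; replicate; cartesianProduct; cartesianProductWith)
open import Data.Nat.ListAction using (sum)
import Data.List.Properties as ListP
open import Data.List.Membership.Propositional using (_∈_)
import Data.List.Membership.Propositional.Properties as ∈P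
import Data.List.Membership.DecPropositional ℕP._≟_ as ∈ℕ
open import Data.List.Relation.Unary.Any using (here; there)
open import Data.List.Relation.Unary.All as All using (All; []; _∷_)
import Data.List.Relation.Unary.All.Properties as AllP
open import Data.List.Relation.Unary.AllPairs using ([]; _∷_)
open import Data.List.Relation.Unary.Linked as Linked using (Linked; []; [-]; _∷_)
open import Data.List.Relation.Unary.Unique.Propositional using (Unique)
import Data.List.Relation.Unary.Unique.Propositional.Properties as UniqueP
open import Relation.Binary.PropositionalEquality using (_≡_; _≢_; refl; sym; trans; cong; subst)
open import Relation.Nullary using (¬_; Dec; yes; no)
open import Relation.Nullary.Decidable using (_×-dec_; _⊎-dec_; ¬?)
open import Relation.Unary using (Pred; Decidable)

private
  variable
    A : Set

-- A nonempty finite set { a | P a }, listed without repetition.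
record Enumeration (P : Pred A 0ℓ) : Set where
  field
    elements  : List A
    unique    : Unique elements
    sound     : ∀ {a} → a ∈ elements → P a
    complete  : ∀ {a} → P a → a ∈ elements
    inhabited : ∃ P

  nonZero : ℕ.NonZero (length elements)
  nonZero = go (complete (proj₂ inhabited))
    where
    go : ∀ {a xs} → a ∈ xs → ℕ.NonZero (length xs)
    go (here _)  = _
    go (there _) = _

-- Expected value of f at an element drawn uniformly at random.
expectation : {P : Pred A 0ℓ} → Enumeration P → (A → ℕ) → ℚ
expectation e f = (+ sum (map f elements)) ℚ./ length elements
  where
  open Enumeration e
  instance _ = nonZero

private
  words≤ : List A → ℕ → List (List A)
  words≤ as zero    = [] ∷ []
  words≤ as (suc k) = [] ∷ cartesianProductWith _∷_ as (words≤ as k)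

  words≤-unique : ∀ {as : List A} → Unique as → ∀ k → Unique (words≤ as k)
  words≤-unique u zero = [] ∷ []
  words≤-unique {as = as} u (suc k) =
    All.tabulate (λ w∈ eq → notNil (∈P.∈-cartesianProductWith⁻ _∷_ as _ w∈) eq)
    ∷ UniqueP.cartesianProductWith⁺ _∷_ ListP.∷-injective u (words≤-unique u k)
    where
    notNil : ∀ {w bs cs} → ∃[ b ] ∃[ c ] (b ∈ bs × c ∈ cs × w ≡ b ∷ c) → [] ≢ w
    notNil (_ , _ , _ , _ , refl) ()

  words≤-complete : ∀ {as : List A} {k w} → All (_∈ as) w → length w ℕ.≤ k →
                    w ∈ words≤ as k
  words≤-complete {k = zero}  []        _         = here refl
  words≤-complete {k = suc k} []        _         = here refl
  words≤-complete {k = suc k} (a∈ ∷ w∈) (s≤s w≤k) =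
    there (∈P.∈-cartesianProductWith⁺ _∷_ a∈ (words≤-complete w∈ w≤k))

  filterEnumeration : {P : Pred A 0ℓ} → Decidable P → (as : List A) → Unique as →
                      (∀ {a} → P a → a ∈ as) → ∃ P → Enumeration P
  filterEnumeration P? as u c i = record
    { elements  = filter P? as
    ; unique    = UniqueP.filter⁺ P? u
    ; sound     = λ a∈ → proj₂ (∈P.∈-filter⁻ P? {xs = as} a∈)
    ; complete  = λ p → ∈P.∈-filter⁺ P? (c p) p
    ; inhabited = i
    }

data Step : Set where
  N N̄ E Ē : Step

Δx : Step → ℤ
Δx N = + 1
Δx N̄ = + 1
Δx E = + 2
Δx Ē = + 2

Δy : Step → ℤ
Δy N = + 2
Δy N̄ = ℤ.- (+ 2)
Δy E = + 1
Δy Ē = ℤ.- (+ 1)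

-- A path starts at the origin, so it is determined by its steps.
Path : Set
Path = List Step

endpoint : Path → ℤ × ℤ
endpoint []      = 0ℤ , 0ℤ
endpoint (s ∷ w) = Δx s ℤ.+ proj₁ (endpoint w) , Δy s ℤ.+ proj₂ (endpoint w)

size : Path → ℤ
size w = proj₁ (endpoint w)

EndsOnXAxis : Path → Set
EndsOnXAxis w = proj₂ (endpoint w) ≡ 0ℤ

OppositeDirections : Step → Step → Set
OppositeDirections s t = ℤ.sign (Δy s) ≢ ℤ.sign (Δy t)

GrandZigzag : Path → Set
GrandZigzag = Linked OppositeDirections

ZigzagOnXAxis : ℕ → Path → Set
ZigzagOnXAxis m w = GrandZigzag w × size w ≡ + m × EndsOnXAxis w

steps : Path → ℕ
steps = length

private
  allSteps : List Step
  allSteps = N ∷ N̄ ∷ E ∷ Ē ∷ []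

  ∈-allSteps : ∀ s → s ∈ allSteps
  ∈-allSteps N = here refl
  ∈-allSteps N̄ = there (here refl)
  ∈-allSteps E = there (there (here refl))
  ∈-allSteps Ē = there (there (there (here refl)))

  allSteps-unique : Unique allSteps
  allSteps-unique =
    ((λ ()) ∷ (λ ()) ∷ (λ ()) ∷ []) ∷ ((λ ()) ∷ (λ ()) ∷ []) ∷ ((λ ()) ∷ []) ∷ [] ∷ []

  1≤Δx : ∀ s → + 1 ℤ.≤ Δx s
  1≤Δx N = ℤ.+≤+ (s≤s z≤n)
  1≤Δx N̄ = ℤ.+≤+ (s≤s z≤n)
  1≤Δx E = ℤ.+≤+ (s≤s z≤n)
  1≤Δx Ē = ℤ.+≤+ (s≤s z≤n)

  steps≤size : ∀ w → + steps w ℤ.≤ size w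
  steps≤size []      = ℤ.+≤+ z≤n
  steps≤size (s ∷ w) = ℤP.+-mono-≤ (1≤Δx s) (steps≤size w)

  zigzagOnXAxis? : ∀ m → Decidable (ZigzagOnXAxis m)
  zigzagOnXAxis? m w =
    Linked.linked? (λ s t → ¬? (ℤ.sign (Δy s) SignP.≟ ℤ.sign (Δy t))) w
    ×-dec (size w ℤP.≟ + m) ×-dec (proj₂ (endpoint w) ℤP.≟ 0ℤ)

  zigzag : ℕ → Path
  zigzag zero    = []
  zigzag (suc n) = N ∷ N̄ ∷ zigzag n

  zigzag-grand : ∀ n → GrandZigzag (zigzag n)
  zigzag-grand zero          = []
  zigzag-grand (suc zero)    = (λ ()) ∷ [-]
  zigzag-grand (suc (suc n)) = (λ ()) ∷ (λ ()) ∷ zigzag-grand (suc n)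

  zigzag-size : ∀ n → size (zigzag n) ≡ + (2 ℕ.* n)
  zigzag-size zero    = refl
  zigzag-size (suc n) rewrite zigzag-size n =
    cong (λ k → + suc k) (sym (ℕP.+-suc n (n ℕ.+ 0)))

  zigzag-axis : ∀ n → EndsOnXAxis (zigzag n)
  zigzag-axis zero    = refl
  zigzag-axis (suc n) rewrite zigzag-axis n = refl

paths : ∀ n → Enumeration (ZigzagOnXAxis (2 ℕ.* n))
paths n = filterEnumeration (zigzagOnXAxis? (2 ℕ.* n))
  (words≤ allSteps (2 ℕ.* n))
  (words≤-unique allSteps-unique (2 ℕ.* n))
  (λ {w} (_ , eq , _) → words≤-complete (All.tabulate (λ {s} _ → ∈-allSteps s))
    (ℤP.drop‿+≤+ (subst (+ steps w ℤ.≤_) eq (steps≤size w))))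
  (zigzag n , zigzag-grand n , zigzag-size n , zigzag-axis n)

expectedSteps : ℕ → ℚ
expectedSteps n = expectation (paths n) steps

Composition : ℕ → List ℕ → Set
Composition n X = All (1 ℕ.≤_) X × sum X ≡ n

PartsIn : List ℕ → List ℕ → Set
PartsIn S = All (_∈ S)

Composition₁₂ : ℕ → List ℕ → Set
Composition₁₂ n X = Composition n X × PartsIn (1 ∷ 2 ∷ []) X

CompositionPair : ℕ → List ℕ × List ℕ → Set
CompositionPair n (X , Y) =
  Composition₁₂ n X × Composition₁₂ n Y × length X ≡ length Y

parts : List ℕ × List ℕ → ℕ
parts (X , Y) = length X ℕ.+ length Y

private
  composition₁₂? : ∀ n → Decidable (Composition₁₂ n)
  composition₁₂? n X =
    (All.all? (1 ℕP.≤?_) X ×-dec (sum X ℕP.≟ n))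
    ×-dec All.all? (∈ℕ._∈? (1 ∷ 2 ∷ [])) X

  compositionPair? : ∀ n → Decidable (CompositionPair n)
  compositionPair? n (X , Y) =
    composition₁₂? n X ×-dec composition₁₂? n Y ×-dec (length X ℕP.≟ length Y)

  length≤sum : ∀ {X} → All (1 ℕ.≤_) X → length X ℕ.≤ sum X
  length≤sum []       = z≤n
  length≤sum (p ∷ ps) = ℕP.+-mono-≤ p (length≤sum ps)

  candidates : ℕ → List (List ℕ)
  candidates = words≤ (1 ∷ 2 ∷ [])

  candidates-unique : ∀ n → Unique (candidates n)
  candidates-unique = words≤-unique (((λ ()) ∷ []) ∷ [] ∷ [])

  ∈-candidates : ∀ {n X} → Composition₁₂ n X → X ∈ candidates n
  ∈-candidates ((ps , refl) , X∈) = words≤-complete X∈ (length≤sum ps)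

  ones : ∀ n → Composition₁₂ n (replicate n 1)
  ones n = (AllP.replicate⁺ n (s≤s z≤n) , sum-ones n) , AllP.replicate⁺ n (here refl)
    where
    sum-ones : ∀ n → sum (replicate n 1) ≡ n
    sum-ones zero    = refl
    sum-ones (suc n) = cong suc (sum-ones n)

compositionPairs : ∀ n → Enumeration (CompositionPair n)
compositionPairs n = filterEnumeration (compositionPair? n)
  (cartesianProduct (candidates n) (candidates n))
  (UniqueP.cartesianProduct⁺ (candidates-unique n) (candidates-unique n))
  (λ (cX , cY , _) → ∈P.∈-cartesianProduct⁺ (∈-candidates cX) (∈-candidates cY))
  ((replicate n 1 , replicate n 1) , ones n , ones n , refl)

expectedParts : ℕ → ℚ
expectedParts n = expectation (compositionPairs n) parts

-- The real quadratic field ℚ(√5), which contains every number occurring in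
-- the asymptotics.  It is ordered as a subfield of the reals, √5 > 0.

infix 5 _+_√5

-- a + b √5 represents the real number a + b√5, uniquely as √5 is irrational.
record ℚ√5 : Set where
  constructor _+_√5
  field
    rational   : ℚ
    irrational : ℚ

open ℚ√5 public

infixl 6 _⊕_ _⊖_
infixl 7 _⊗_ _⊘_
infix  4 _<_ _≤_ _∼_

fromℚ : ℚ → ℚ√5
fromℚ q = q + 0ℚ √5

fromℕ : ℕ → ℚ√5
fromℕ n = fromℚ ((+ n) ℚ./ 1)

√5 : ℚ√5
√5 = 0ℚ + 1ℚ √5

_⊕_ _⊖_ _⊗_ : ℚ√5 → ℚ√5 → ℚ√5
(a + b √5) ⊕ (c + d √5) = (a ℚ.+ c) + (b ℚ.+ d) √5
(a + b √5) ⊖ (c + d √5) = (a ℚ.- c) + (b ℚ.- d) √5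
(a + b √5) ⊗ (c + d √5) =
  (a ℚ.* c ℚ.+ ((+ 5) ℚ./ 1) ℚ.* (b ℚ.* d)) + (a ℚ.* d ℚ.+ b ℚ.* c) √5

conjugate : ℚ√5 → ℚ√5
conjugate (a + b √5) = a + (ℚ.- b) √5

norm : ℚ√5 → ℚ
norm x = (x ⊗ conjugate x) .rational

-- x / y = x ȳ / (y ȳ), where y ȳ is rational.
_⊘_ : (x y : ℚ√5) → .{{_ : ℚ.NonZero (norm y)}} → ℚ√5
x ⊘ y = x ⊗ conjugate y ⊗ fromℚ (ℚ.1/ norm y)

-- The sign of a + b√5 is that of whichever of a and b√5 is larger in absolute
-- value; the two absolute values agree only for a = b = 0.
Positive : ℚ√5 → Set
Positive (a + b √5) =
    (0ℚ ℚ.< a × 5b² ℚ.< a²)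
  ⊎ (0ℚ ℚ.< b × a² ℚ.< 5b²)
  where
  a² 5b² : ℚ
  a²  = a ℚ.* a
  5b² = ((+ 5) ℚ./ 1) ℚ.* (b ℚ.* b)

positive? : Decidable Positive
positive? (a + b √5) =
  (_ ℚP.<? _ ×-dec _ ℚP.<? _) ⊎-dec (_ ℚP.<? _ ×-dec _ ℚP.<? _)

_<_ _≤_ : ℚ√5 → ℚ√5 → Set
x < y = Positive (y ⊖ x)
x ≤ y = x < y ⊎ x ≡ y

abs : ℚ√5 → ℚ√5
abs x with positive? x
... | yes _ = x
... | no  _ = fromℕ 0 ⊖ x

-- Asymptotic equivalence, f - g = o(g).  Rational ε suffice, as every positive
-- real number exceeds a positive rational.
_∼_ : (f g : ℕ → ℚ√5) → Set
f ∼ g = ∀ (ε : ℚ) → 0ℚ ℚ.< ε →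
  ∃[ n₀ ] (∀ n → n₀ ℕ.≤ n → abs (f n ⊖ g n) ≤ fromℚ ε ⊗ abs (g n))

{-# OPTIONS --safe #-}

-- Up-steps of width x have height 3 − x and down-steps of width x have height x − 3.  Hence a path of
-- size 2 n ending on the axis has as many up-steps as down-steps, and the widths of either kind form a
-- composition of n.  Conversely a pair of compositions with equally many parts is interleaved in two
-- ways, starting up or down, so that for n ≥ 1 paths and pairs correspond 2 : 1, which preserves means.
--
-- There are w = C(z + b, b)² pairs with z ones and b twos on either side (z + 2 b = n), having n + z
-- parts in all.  Put u = 5 z² − n².  The two-term recurrence for the binomials makes
-- Σ w (u b² (z + b + 1)² − u′ z² (z − 1)²) telescope to 0, where u′ = 5 (z − 2)² − n².  Since
-- 2 b = n − z, the bracket is − u² (n² + 3 z²) / 16 up to O(n⁵), so the mean of u² is O(n³).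
-- For y, z ≥ 0 we have 5 (z − y)² ≤ |u(z) − u(y)|, so z also has small variance and 5 (E z)² is close
-- to n², that is, E z ~ n / √5.

module Submission where

open import Level using (0ℓ)
open import Algebra using (AbelianGroup)
open import Data.Nat as ℕ using (ℕ; zero; suc; z≤n; s≤s)
import Data.Nat.Properties as ℕP
open import Data.Nat.Divisibility using (divides)
open import Data.Nat.Induction using (<-rec)
open import Data.Nat.ListAction using (sum)
open import Data.Nat.ListAction.Properties using (sum-↭; sum-++)
open import Data.Nat.Primality using (Prime; prime?; euclidsLemma)
open import Data.Integer as ℤ using (ℤ)
import Data.Integer.Properties as ℤP
open import Data.Rational as ℚ using (ℚ; 0ℚ; 1ℚ)
import Data.Rational.Properties as ℚP
import Data.Rational.Unnormalised as ℚᵘ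
import Data.Rational.Unnormalised.Properties as ℚᵘP
open import Data.Product using (∃-syntax; _×_; _,_; proj₁; proj₂; uncurry)
open import Data.Sum using (_⊎_; inj₁; inj₂; reduce)
open import Data.List using (List; []; _∷_; _++_; length; map; cartesianProduct)
import Data.List.Properties as ListP
open import Data.List.Membership.Propositional using (_∈_)
import Data.List.Membership.Propositional.Properties as ∈P
open import Data.List.Membership.Propositional.Properties.WithK using (unique∧set⇒bag)
open import Data.List.Relation.Unary.Any using (here; there)
open import Data.List.Relation.Unary.All as All using (All; []; _∷_)
open import Data.List.Relation.Unary.AllPairs as AllPairs using ([]; _∷_)
import Data.List.Relation.Unary.AllPairs.Properties as AllPairsP
open import Data.List.Relation.Unary.Linked as Linked using ([]; [-]; _∷_)
open import Data.List.Relation.Unary.Unique.Propositional using (Unique)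
import Data.List.Relation.Unary.Unique.Propositional.Properties as UniqueP
open import Data.List.Relation.Binary.Permutation.Propositional using (_↭_)
import Data.List.Relation.Binary.Permutation.Propositional.Properties as ↭P
open import Data.List.Relation.Binary.BagAndSetEquality using (∼bag⇒↭)
open import Function.Bundles using (mk⇔)
open import Relation.Binary.Definitions using (tri<; tri≈; tri>)
open import Relation.Binary.PropositionalEquality
open import Relation.Nullary using (¬_; yes; no; contradiction)
open import Relation.Nullary.Decidable using (dec⇒maybe; from-yes)
open import Relation.Unary using (Pred)
open import Tactic.RingSolver.Core.AlmostCommutativeRing using (AlmostCommutativeRing; fromCommutativeRing)

-- The test function u comes from the ratio of neighbouring weights. Trading a two for two ones on
-- either side multiplies the weight by about (b (z + b) / z²)², and with 2 b = n - z the difference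
-- b (z + b) - z² is - u / 4. So the weights peak where u = 0, at z = n / √5, and multiplication by
-- u turns the drift towards the peak into a square. A bound on the mean of u² controls only E z².
-- The upper bound on E z follows by Jensen, but the lower one needs the variance, hence the
-- comparison of two independent points y and z. The estimates stay in ℤ until the end: means are
-- not divided by the total weight, and ε is represented by a natural number M, its denominator, so
-- that 1 / M ≤ ε. Each estimate is then a polynomial inequality certified by an identity with
-- nonnegative terms. M balances M u against n² in AM-GM: since E u² ≤ 1600 n³, the condition 6400
-- M² ≤ n gives 4 M² E u² ≤ n⁴.

-- Compositions into ones and twos, and their pairs sorted by the number of twos

module Words where
  open import Defs
  open import Data.Nat using (_+_; _*_)
  open import Data.Nat.Tactic.RingSolver using (solve-∀)

  unique∧set⇒↭ : ∀ {A : Set} {xs ys : List A} → Unique xs → Unique ys →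
                 (∀ {x} → x ∈ xs → x ∈ ys) → (∀ {x} → x ∈ ys → x ∈ xs) → xs ↭ ys
  unique∧set⇒↭ u v f g = ∼bag⇒↭ (unique∧set⇒bag u v (mk⇔ f g))

  sum-map-const : ∀ {A : Set} (f : A → ℕ) {c} (xs : List A) →
                  (∀ {x} → x ∈ xs → f x ≡ c) → sum (map f xs) ≡ length xs * c
  sum-map-const f []       eq = refl
  sum-map-const f (x ∷ xs) eq =
    cong₂ _+_ (eq (here refl)) (sum-map-const f xs (λ x∈ → eq (there x∈)))

  +-2*suc : ∀ a b → a + 2 * suc b ≡ 2 + (a + 2 * b)
  +-2*suc = solve-∀

  data Word : ℕ → ℕ → List ℕ → Set where
    []  : Word 0 0 []
    1∷_ : ∀ {a b X} → Word a b X → Word (suc a) b (1 ∷ X)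
    2∷_ : ∀ {a b X} → Word a b X → Word a (suc b) (2 ∷ X)

  Word-length : ∀ {a b X} → Word a b X → length X ≡ a + b
  Word-length []         = refl
  Word-length (1∷ w)     = cong suc (Word-length w)
  Word-length {a} {suc b} (2∷ w) = trans (cong suc (Word-length w)) (sym (ℕP.+-suc a b))

  Word⇒composition : ∀ {a b X} → Word a b X → Composition₁₂ (a + 2 * b) X
  Word⇒composition [] = ([] , refl) , []
  Word⇒composition (1∷ w) with (ps , eq) , qs ← Word⇒composition w =
    (s≤s z≤n ∷ ps , cong suc eq) , here refl ∷ qs
  Word⇒composition {a} {suc b} (2∷ w) with (ps , eq) , qs ← Word⇒composition w =
    (s≤s z≤n ∷ ps , trans (cong (2 +_) eq) (sym (+-2*suc a b))) , there (here refl) ∷ qs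

  PartsIn⇒Word : ∀ {X} → PartsIn (1 ∷ 2 ∷ []) X → ∃[ a ] ∃[ b ] Word a b X
  PartsIn⇒Word [] = 0 , 0 , []
  PartsIn⇒Word (here refl ∷ qs)         with a , b , w ← PartsIn⇒Word qs = suc a , b , 1∷ w
  PartsIn⇒Word (there (here refl) ∷ qs) with a , b , w ← PartsIn⇒Word qs = a , suc b , 2∷ w

  composition⇒Word : ∀ {n X} → Composition₁₂ n X → ∃[ a ] ∃[ b ] (Word a b X × n ≡ a + 2 * b)
  composition⇒Word ((_ , refl) , qs) with a , b , w ← PartsIn⇒Word qs =
    a , b , w , proj₂ (proj₁ (Word⇒composition w))

  Word-unique : ∀ {a b a′ b′ X} → Word a b X → Word a′ b′ X → b ≡ b′
  Word-unique []     []      = refl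
  Word-unique (1∷ w) (1∷ w′) = Word-unique w w′
  Word-unique (2∷ w) (2∷ w′) = cong suc (Word-unique w w′)

  words : ℕ → ℕ → List (List ℕ)
  words zero    zero    = [] ∷ []
  words zero    (suc b) = map (2 ∷_) (words zero b)
  words (suc a) zero    = map (1 ∷_) (words a zero)
  words (suc a) (suc b) = map (1 ∷_) (words a (suc b)) ++ map (2 ∷_) (words (suc a) b)

  -- binomial a b is (a + b) C a.
  binomial : ℕ → ℕ → ℕ
  binomial zero    b       = 1
  binomial (suc a) zero    = 1
  binomial (suc a) (suc b) = binomial a (suc b) + binomial (suc a) b

  binomial-zeroʳ : ∀ a → binomial a 0 ≡ 1
  binomial-zeroʳ zero    = refl
  binomial-zeroʳ (suc a) = refl

  length-words : ∀ a b → length (words a b) ≡ binomial a b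
  length-words zero    zero    = refl
  length-words zero    (suc b) = trans (ListP.length-map _ (words zero b)) (length-words zero b)
  length-words (suc a) zero    =
    trans (ListP.length-map _ (words a zero)) (trans (length-words a zero) (binomial-zeroʳ a))
  length-words (suc a) (suc b) =
    trans (ListP.length-++ (map (1 ∷_) (words a (suc b))))
      (cong₂ _+_ (trans (ListP.length-map _ (words a (suc b))) (length-words a (suc b)))
                 (trans (ListP.length-map _ (words (suc a) b)) (length-words (suc a) b)))

  words-sound : ∀ a b {X} → X ∈ words a b → Word a b X
  words-sound zero    zero    (here refl) = []
  words-sound zero    (suc b) X∈ with _ , Y∈ , refl ← ∈P.∈-map⁻ (2 ∷_) X∈ = 2∷ words-sound zero b Y∈
  words-sound (suc a) zero    X∈ with _ , Y∈ , refl ← ∈P.∈-map⁻ (1 ∷_) X∈ = 1∷ words-sound a zero Y∈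
  words-sound (suc a) (suc b) X∈ with ∈P.∈-++⁻ (map (1 ∷_) (words a (suc b))) X∈
  ... | inj₁ X∈₁ with _ , Y∈ , refl ← ∈P.∈-map⁻ (1 ∷_) X∈₁ = 1∷ words-sound a (suc b) Y∈
  ... | inj₂ X∈₂ with _ , Y∈ , refl ← ∈P.∈-map⁻ (2 ∷_) X∈₂ = 2∷ words-sound (suc a) b Y∈

  words-complete : ∀ {a b X} → Word a b X → X ∈ words a b
  words-complete [] = here refl
  words-complete {suc a} {zero}  (1∷ w) = ∈P.∈-map⁺ (1 ∷_) (words-complete w)
  words-complete {suc a} {suc b} (1∷ w) = ∈P.∈-++⁺ˡ (∈P.∈-map⁺ (1 ∷_) (words-complete w))
  words-complete {zero}  {suc b} (2∷ w) = ∈P.∈-map⁺ (2 ∷_) (words-complete w)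
  words-complete {suc a} {suc b} (2∷ w) =
    ∈P.∈-++⁺ʳ (map (1 ∷_) (words a (suc b))) (∈P.∈-map⁺ (2 ∷_) (words-complete w))

  words-unique : ∀ a b → Unique (words a b)
  words-unique zero    zero    = [] ∷ []
  words-unique zero    (suc b) = UniqueP.map⁺ ListP.∷-injectiveʳ (words-unique zero b)
  words-unique (suc a) zero    = UniqueP.map⁺ ListP.∷-injectiveʳ (words-unique a zero)
  words-unique (suc a) (suc b) = UniqueP.++⁺
    (UniqueP.map⁺ ListP.∷-injectiveʳ (words-unique a (suc b)))
    (UniqueP.map⁺ ListP.∷-injectiveʳ (words-unique (suc a) b))
    λ (X∈₁ , X∈₂) → disjoint (∈P.∈-map⁻ (1 ∷_) X∈₁) (∈P.∈-map⁻ (2 ∷_) X∈₂)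
    where
    disjoint : ∀ {X : List ℕ} {Ys Zs} → ∃[ Y ] (Y ∈ Ys × X ≡ 1 ∷ Y) → ¬ (∃[ Y ] (Y ∈ Zs × X ≡ 2 ∷ Y))
    disjoint (_ , _ , refl) (_ , _ , ())

  block : ℕ → ℕ → List (List ℕ × List ℕ)
  block a b = cartesianProduct (words a b) (words a b)

  -- The pairs with a′ ones and b′ twos on either side, for all a′ + 2 b′ = a + 2 b with b′ ≥ b.
  pairs : ℕ → ℕ → List (List ℕ × List ℕ)
  pairs zero          b = block 0 b
  pairs (suc zero)    b = block 1 b
  pairs (suc (suc a)) b = block (suc (suc a)) b ++ pairs a (suc b)

  BlockPair : ℕ → ℕ → List ℕ × List ℕ → Set
  BlockPair a b (X , Y) = Word a b X × Word a b Y

  block-sound : ∀ a b {p} → p ∈ block a b → BlockPair a b p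
  block-sound a b p∈ with X∈ , Y∈ ← ∈P.∈-cartesianProduct⁻ (words a b) (words a b) p∈ =
    words-sound a b X∈ , words-sound a b Y∈

  block-complete : ∀ {a b p} → BlockPair a b p → p ∈ block a b
  block-complete (v , w) = ∈P.∈-cartesianProduct⁺ (words-complete v) (words-complete w)

  pairs-sound : ∀ a b {p} → p ∈ pairs a b →
                ∃[ a′ ] ∃[ b′ ] (b ℕ.≤ b′ × a′ + 2 * b′ ≡ a + 2 * b × BlockPair a′ b′ p)
  pairs-sound zero          b p∈ = 0 , b , ℕP.≤-refl , refl , block-sound 0 b p∈
  pairs-sound (suc zero)    b p∈ = 1 , b , ℕP.≤-refl , refl , block-sound 1 b p∈
  pairs-sound (suc (suc a)) b p∈ with ∈P.∈-++⁻ (block (suc (suc a)) b) p∈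
  ... | inj₁ p∈₁ = suc (suc a) , b , ℕP.≤-refl , refl , block-sound (suc (suc a)) b p∈₁
  ... | inj₂ p∈₂ with a′ , b′ , b<b′ , eq , ws ← pairs-sound a (suc b) p∈₂ =
    a′ , b′ , ℕP.<⇒≤ b<b′ , trans eq (+-2*suc a b) , ws

  -- The induction is on `d`, the number of blocks that precede the one containing the pair; each
  -- step of `pairs` trades two ones for a two on either side.
  pairs-complete : ∀ a b d {a′ p} → a ≡ a′ + 2 * d → BlockPair a′ (b + d) p → p ∈ pairs a b
  pairs-complete a b zero {a′} refl ws rewrite ℕP.+-identityʳ b | ℕP.+-identityʳ a′ with a′
  ... | zero        = block-complete ws
  ... | suc zero    = block-complete ws
  ... | suc (suc _) = ∈P.∈-++⁺ˡ (block-complete ws)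
  pairs-complete a b (suc d) {a′} {p} eq ws with a | trans eq (+-2*suc a′ d)
  ... | suc (suc a) | eq′ = ∈P.∈-++⁺ʳ (block (suc (suc a)) b)
    (pairs-complete a (suc b) d (ℕP.suc-injective (ℕP.suc-injective eq′))
      (subst (λ e → BlockPair a′ e p) (ℕP.+-suc b d) ws))

  block-unique : ∀ a b → Unique (block a b)
  block-unique a b = UniqueP.cartesianProduct⁺ (words-unique a b) (words-unique a b)

  pairs-unique : ∀ a b → Unique (pairs a b)
  pairs-unique zero          b = block-unique 0 b
  pairs-unique (suc zero)    b = block-unique 1 b
  pairs-unique (suc (suc a)) b = UniqueP.++⁺ (block-unique (suc (suc a)) b) (pairs-unique a (suc b))
    λ (p∈₁ , p∈₂) → disjoint (block-sound (suc (suc a)) b p∈₁) (pairs-sound a (suc b) p∈₂)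
    where
    disjoint : ∀ {p c} → BlockPair (2 + a) b p →
               ¬ (∃[ a′ ] ∃[ b′ ] (b ℕ.< b′ × a′ + 2 * b′ ≡ c × BlockPair a′ b′ p))
    disjoint (w , _) (_ , _ , b<b′ , _ , w′ , _) = ℕP.<⇒≢ b<b′ (Word-unique w w′)

  ∈-pairs⇒CompositionPair : ∀ n {p} → p ∈ pairs n 0 → CompositionPair n p
  ∈-pairs⇒CompositionPair n p∈ with a , b , _ , eq , v , w ← pairs-sound n 0 p∈
    with refl ← trans (sym (ℕP.+-identityʳ n)) (sym eq) =
    Word⇒composition v , Word⇒composition w , trans (Word-length v) (sym (Word-length w))

  -- The length `a + b` and the sum `a + 2 * b` together determine `a` and `b`, so both components
  -- of a pair have the same numbers of ones and of twos and lie in a common block.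
  CompositionPair⇒∈-pairs : ∀ n {p} → CompositionPair n p → p ∈ pairs n 0
  CompositionPair⇒∈-pairs n (cX , cY , eq)
    with a , b , v , n≡ ← composition⇒Word cX | a′ , b′ , w , n≡′ ← composition⇒Word cY
    = pairs-complete n 0 b n≡ (v , subst₂ (λ a b → Word a b _) (sym a≡a′) (sym b≡b′) w)
    where
    lengths : a + b ≡ a′ + b′
    lengths = trans (sym (Word-length v)) (trans eq (Word-length w))
    split : ∀ a b → a + 2 * b ≡ (a + b) + b
    split = solve-∀
    b≡b′ : b ≡ b′
    b≡b′ = ℕP.+-cancelˡ-≡ (a + b) _ _ (begin
      (a + b) + b    ≡⟨ split a b ⟨
      a + 2 * b      ≡⟨ trans (sym n≡) n≡′ ⟩
      a′ + 2 * b′    ≡⟨ split a′ b′ ⟩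
      (a′ + b′) + b′ ≡⟨ cong (_+ b′) lengths ⟨
      (a + b) + b′   ∎)
      where open ≡-Reasoning
    a≡a′ : a ≡ a′
    a≡a′ = ℕP.+-cancelʳ-≡ b _ _ (trans lengths (cong (a′ +_) (sym b≡b′)))

  compositionPairs-↭ : ∀ n → Enumeration.elements (compositionPairs n) ↭ pairs n 0
  compositionPairs-↭ n = unique∧set⇒↭ unique (pairs-unique n 0)
    (λ p∈ → CompositionPair⇒∈-pairs n (sound p∈))
    (λ p∈ → complete (∈-pairs⇒CompositionPair n p∈))
    where open Enumeration (compositionPairs n)

open Words

-- The 2 : 1 correspondence between paths and pairs of compositions

module ZigzagPaths where
  open import Defs
  open import Data.Nat using (_+_; _*_)
  open import Data.Nat.Tactic.RingSolver using (solve-∀)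
  import Data.Integer.Tactic.RingSolver as ℤS
  open import Algebra.Properties.Group (AbelianGroup.group ℤP.+-0-abelianGroup) using (identityˡ-unique)

  ups downs : Path → List ℕ
  ups []      = []
  ups (N ∷ w) = 1 ∷ ups w
  ups (E ∷ w) = 2 ∷ ups w
  ups (N̄ ∷ w) = ups w
  ups (Ē ∷ w) = ups w
  downs []      = []
  downs (N ∷ w) = downs w
  downs (E ∷ w) = downs w
  downs (N̄ ∷ w) = 1 ∷ downs w
  downs (Ē ∷ w) = 2 ∷ downs w

  upStep downStep : ℕ → Step
  upStep 1   = N
  upStep _   = E
  downStep 1 = N̄
  downStep _ = Ē

  -- When the list whose turn it is runs out, the rest of the other is dropped. Nothing is lost if
  -- the list that goes first is as long as the other or longer by one.
  upFirst downFirst : List ℕ → List ℕ → Path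
  upFirst   []      _       = []
  upFirst   (x ∷ X) Y       = upStep x ∷ downFirst X Y
  downFirst _       []      = []
  downFirst X       (y ∷ Y) = downStep y ∷ upFirst X Y

  size-ups-downs : ∀ w → size w ≡ ℤ.+ (sum (ups w) + sum (downs w))
  size-ups-downs []      = refl
  size-ups-downs (N ∷ w) rewrite size-ups-downs w = refl
  size-ups-downs (E ∷ w) rewrite size-ups-downs w = refl
  size-ups-downs (N̄ ∷ w) rewrite size-ups-downs w = cong ℤ.+_ (sym (ℕP.+-suc (sum (ups w)) _))
  size-ups-downs (Ē ∷ w) rewrite size-ups-downs w = cong ℤ.+_ (arith (sum (ups w)) _)
    where
    arith : ∀ a b → 2 + (a + b) ≡ a + (2 + b)
    arith = solve-∀

  -- A step of width x has height ± (3 − x).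
  height-ups-downs : ∀ w → proj₂ (endpoint w) ℤ.+ ℤ.+ (sum (ups w) + 3 * length (downs w)) ≡
                           ℤ.+ (sum (downs w) + 3 * length (ups w))
  height-ups-downs []      = refl
  height-ups-downs (s ∷ w) = step s
    where
    A = sum (ups w) + 3 * length (downs w)
    B = sum (downs w) + 3 * length (ups w)
    h = proj₂ (endpoint w)
    +-3*suc : ∀ a k → a + 3 * suc k ≡ 3 + (a + 3 * k)
    +-3*suc = solve-∀
    interchange : ∀ d h e m → (d ℤ.+ h) ℤ.+ (e ℤ.+ m) ≡ (d ℤ.+ e) ℤ.+ (h ℤ.+ m)
    interchange = ℤS.solve-∀
    shift : ∀ d e {A′ B′} → A′ ≡ e + A → (d ℤ.+ ℤ.+ e) ℤ.+ ℤ.+ B ≡ ℤ.+ B′ →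
            (d ℤ.+ h) ℤ.+ ℤ.+ A′ ≡ ℤ.+ B′
    shift d e refl eq = trans (interchange d h (ℤ.+ e) (ℤ.+ A))
      (trans (cong (λ i → (d ℤ.+ ℤ.+ e) ℤ.+ i) (height-ups-downs w)) eq)
    step : ∀ s → proj₂ (endpoint (s ∷ w)) ℤ.+ ℤ.+ (sum (ups (s ∷ w)) + 3 * length (downs (s ∷ w))) ≡
                 ℤ.+ (sum (downs (s ∷ w)) + 3 * length (ups (s ∷ w)))
    -- Height plus width of an up-step is 3, the gain on the right from one more entry in `ups`. For
    -- a down-step the 3 comes from `length (downs w)` on the left, and 3 plus its height is its
    -- width.
    step N = shift (Δy N) 1 refl (cong ℤ.+_ (sym (+-3*suc (sum (downs w)) (length (ups w)))))
    step E = shift (Δy E) 2 refl (cong ℤ.+_ (sym (+-3*suc (sum (downs w)) (length (ups w)))))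
    step N̄ = shift (Δy N̄) 3 (+-3*suc (sum (ups w)) (length (downs w))) refl
    step Ē = shift (Δy Ē) 3 (+-3*suc (sum (ups w)) (length (downs w))) refl

  data StartsUp : Path → Set where
    []  : StartsUp []
    N∷_ : ∀ w → StartsUp (N ∷ w)
    E∷_ : ∀ w → StartsUp (E ∷ w)

  data StartsDown : Path → Set where
    []  : StartsDown []
    N̄∷_ : ∀ w → StartsDown (N̄ ∷ w)
    Ē∷_ : ∀ w → StartsDown (Ē ∷ w)

  startsDown : ∀ {s w} → GrandZigzag (s ∷ w) → StartsUp (s ∷ w) → StartsDown w
  startsDown [-]                 _        = []
  startsDown {w = N ∷ _} (o ∷ _) (N∷ _) = contradiction refl o
  startsDown {w = N ∷ _} (o ∷ _) (E∷ _) = contradiction refl o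
  startsDown {w = E ∷ _} (o ∷ _) (N∷ _) = contradiction refl o
  startsDown {w = E ∷ _} (o ∷ _) (E∷ _) = contradiction refl o
  startsDown {w = N̄ ∷ w} _        _      = N̄∷ w
  startsDown {w = Ē ∷ w} _        _      = Ē∷ w

  startsUp : ∀ {s w} → GrandZigzag (s ∷ w) → StartsDown (s ∷ w) → StartsUp w
  startsUp [-]                 _        = []
  startsUp {w = N̄ ∷ _} (o ∷ _) (N̄∷ _) = contradiction refl o
  startsUp {w = N̄ ∷ _} (o ∷ _) (Ē∷ _) = contradiction refl o
  startsUp {w = Ē ∷ _} (o ∷ _) (N̄∷ _) = contradiction refl o
  startsUp {w = Ē ∷ _} (o ∷ _) (Ē∷ _) = contradiction refl o
  startsUp {w = N ∷ w} _        _      = N∷ w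
  startsUp {w = E ∷ w} _        _      = E∷ w

  step-parity : ∀ {k l} → k ≡ l ⊎ k ≡ suc l → suc l ≡ k ⊎ suc l ≡ suc k
  step-parity (inj₁ k≡l)  = inj₂ (cong suc (sym k≡l))
  step-parity (inj₂ k≡1+l) = inj₁ (sym k≡1+l)

  -- In an alternating path only the first direction is free, so the widths of the two kinds
  -- determine it once that direction is known. Removing the first step exchanges the roles of the
  -- two kinds, which accounts for the mutual induction and for the surplus of at most one step.
  upFirst-ups-downs : ∀ {w} → GrandZigzag w → StartsUp w →
    upFirst (ups w) (downs w) ≡ w ×
    (length (ups w) ≡ length (downs w) ⊎ length (ups w) ≡ suc (length (downs w)))
  downFirst-ups-downs : ∀ {w} → GrandZigzag w → StartsDown w →
    downFirst (ups w) (downs w) ≡ w ×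
    (length (downs w) ≡ length (ups w) ⊎ length (downs w) ≡ suc (length (ups w)))

  upFirst-ups-downs {[]}    z u = refl , inj₁ refl
  upFirst-ups-downs {s ∷ w} z u with eq , l ← downFirst-ups-downs (Linked.tail z) (startsDown z u) | u
  ... | N∷ _ = cong (N ∷_) eq , step-parity l
  ... | E∷ _ = cong (E ∷_) eq , step-parity l

  downFirst-ups-downs {[]}    z d = refl , inj₁ refl
  downFirst-ups-downs {s ∷ w} z d with eq , l ← upFirst-ups-downs (Linked.tail z) (startsUp z d) | d
  ... | N̄∷ _ = cong (N̄ ∷_) eq , step-parity l
  ... | Ē∷ _ = cong (Ē ∷_) eq , step-parity l

  zigzag-starts : ∀ w → StartsUp w ⊎ StartsDown w
  zigzag-starts []      = inj₁ []
  zigzag-starts (N ∷ w) = inj₁ (N∷ w)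
  zigzag-starts (E ∷ w) = inj₁ (E∷ w)
  zigzag-starts (N̄ ∷ w) = inj₂ (N̄∷ w)
  zigzag-starts (Ē ∷ w) = inj₂ (Ē∷ w)

  1or2 : List ℕ → Set
  1or2 = PartsIn (1 ∷ 2 ∷ [])

  1or2-positive : ∀ {X} → 1or2 X → All (1 ℕ.≤_) X
  1or2-positive = All.map λ { (here refl) → s≤s z≤n ; (there (here refl)) → s≤s z≤n }

  1or2-ups : ∀ w → 1or2 (ups w)
  1or2-ups []      = []
  1or2-ups (N ∷ w) = here refl ∷ 1or2-ups w
  1or2-ups (E ∷ w) = there (here refl) ∷ 1or2-ups w
  1or2-ups (N̄ ∷ w) = 1or2-ups w
  1or2-ups (Ē ∷ w) = 1or2-ups w

  1or2-downs : ∀ w → 1or2 (downs w)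
  1or2-downs []      = []
  1or2-downs (N ∷ w) = 1or2-downs w
  1or2-downs (E ∷ w) = 1or2-downs w
  1or2-downs (N̄ ∷ w) = here refl ∷ 1or2-downs w
  1or2-downs (Ē ∷ w) = there (here refl) ∷ 1or2-downs w

  record Splits (w : Path) (X Y : List ℕ) : Set where
    field
      linked : GrandZigzag w
      ups≡   : ups w ≡ X
      downs≡ : downs w ≡ Y
  open Splits
  open Enumeration using (elements; nonZero)

  upFirst-starts : ∀ {X Y} → 1or2 X → StartsUp (upFirst X Y)
  upFirst-starts []                      = []
  upFirst-starts (here refl ∷ _)         = N∷ _
  upFirst-starts (there (here refl) ∷ _) = E∷ _

  downFirst-starts : ∀ {X Y} → 1or2 Y → StartsDown (downFirst X Y)
  downFirst-starts []                      = []
  downFirst-starts (here refl ∷ _)         = N̄∷ _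
  downFirst-starts (there (here refl) ∷ _) = Ē∷ _

  N-linked : ∀ {w} → GrandZigzag w → StartsDown w → GrandZigzag (N ∷ w)
  N-linked z []     = [-]
  N-linked z (N̄∷ w) = (λ ()) ∷ z
  N-linked z (Ē∷ w) = (λ ()) ∷ z

  E-linked : ∀ {w} → GrandZigzag w → StartsDown w → GrandZigzag (E ∷ w)
  E-linked z []     = [-]
  E-linked z (N̄∷ w) = (λ ()) ∷ z
  E-linked z (Ē∷ w) = (λ ()) ∷ z

  N̄-linked : ∀ {w} → GrandZigzag w → StartsUp w → GrandZigzag (N̄ ∷ w)
  N̄-linked z []     = [-]
  N̄-linked z (N∷ w) = (λ ()) ∷ z
  N̄-linked z (E∷ w) = (λ ()) ∷ z

  Ē-linked : ∀ {w} → GrandZigzag w → StartsUp w → GrandZigzag (Ē ∷ w)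
  Ē-linked z []     = [-]
  Ē-linked z (N∷ w) = (λ ()) ∷ z
  Ē-linked z (E∷ w) = (λ ()) ∷ z

  step-parity⁻¹ : ∀ {k l} → suc l ≡ k ⊎ suc l ≡ suc k → k ≡ l ⊎ k ≡ suc l
  step-parity⁻¹ (inj₁ 1+l≡k)   = inj₂ (sym 1+l≡k)
  step-parity⁻¹ (inj₂ 1+l≡1+k) = inj₁ (sym (ℕP.suc-injective 1+l≡1+k))

  upFirst-splits : ∀ {X Y} → 1or2 X → 1or2 Y →
    length X ≡ length Y ⊎ length X ≡ suc (length Y) → Splits (upFirst X Y) X Y
  downFirst-splits : ∀ {X Y} → 1or2 X → 1or2 Y →
    length Y ≡ length X ⊎ length Y ≡ suc (length X) → Splits (downFirst X Y) X Y

  upFirst-splits [] [] _ = record { linked = [] ; ups≡ = refl ; downs≡ = refl }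
  upFirst-splits [] (_ ∷ _) (inj₁ ())
  upFirst-splits [] (_ ∷ _) (inj₂ ())
  upFirst-splits (here refl ∷ p) q l
    with s ← downFirst-splits p q (step-parity⁻¹ l) = record
    { linked = N-linked (linked s) (downFirst-starts q)
    ; ups≡   = cong (1 ∷_) (ups≡ s)
    ; downs≡ = downs≡ s
    }
  upFirst-splits (there (here refl) ∷ p) q l
    with s ← downFirst-splits p q (step-parity⁻¹ l) = record
    { linked = E-linked (linked s) (downFirst-starts q)
    ; ups≡   = cong (2 ∷_) (ups≡ s)
    ; downs≡ = downs≡ s
    }

  downFirst-splits [] [] _ = record { linked = [] ; ups≡ = refl ; downs≡ = refl }
  downFirst-splits (_ ∷ _) [] (inj₁ ())
  downFirst-splits (_ ∷ _) [] (inj₂ ())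
  downFirst-splits p (here refl ∷ q) l
    with s ← upFirst-splits p q (step-parity⁻¹ l) = record
    { linked = N̄-linked (linked s) (upFirst-starts p)
    ; ups≡   = ups≡ s
    ; downs≡ = cong (1 ∷_) (downs≡ s)
    }
  downFirst-splits p (there (here refl) ∷ q) l
    with s ← upFirst-splits p q (step-parity⁻¹ l) = record
    { linked = Ē-linked (linked s) (upFirst-starts p)
    ; ups≡   = ups≡ s
    ; downs≡ = cong (2 ∷_) (downs≡ s)
    }

  steps-ups-downs : ∀ w → steps w ≡ parts (ups w , downs w)
  steps-ups-downs []      = refl
  steps-ups-downs (N ∷ w) = cong suc (steps-ups-downs w)
  steps-ups-downs (E ∷ w) = cong suc (steps-ups-downs w)
  steps-ups-downs (N̄ ∷ w) = trans (cong suc (steps-ups-downs w)) (sym (ℕP.+-suc (length (ups w)) _))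
  steps-ups-downs (Ē ∷ w) = trans (cong suc (steps-ups-downs w)) (sym (ℕP.+-suc (length (ups w)) _))

  split : Path → List ℕ × List ℕ
  split w = ups w , downs w

  Splits⇒ZigzagOnXAxis : ∀ {n w X Y} → CompositionPair n (X , Y) → Splits w X Y → ZigzagOnXAxis (2 * n) w
  Splits⇒ZigzagOnXAxis {n} {w} (((_ , sX) , _) , ((_ , sY) , _) , l)
    record { linked = z ; ups≡ = refl ; downs≡ = refl } =
    z ,
    trans (size-ups-downs w) (cong ℤ.+_ (cong₂ _+_ sX (trans sY (sym (ℕP.+-identityʳ n))))) ,
    -- With equal sums and equal lengths both sides of the height identity contain the same number,
    -- so the final height is 0.
    identityˡ-unique _ (ℤ.+ (sum (downs w) + 3 * length (ups w)))
      (trans (cong (λ m → proj₂ (endpoint w) ℤ.+ ℤ.+ m)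
               (cong₂ (λ s k → s + 3 * k) (trans sY (sym sX)) l))
             (height-ups-downs w))

  -- With one more part on the left the sums would differ by 3, contradicting the even total.
  balanced : ∀ {n a b k l} → a + b ≡ 2 * n → a + 3 * l ≡ b + 3 * k → k ≡ l ⊎ k ≡ suc l → a ≡ n × b ≡ n × k ≡ l
  balanced {n} {a} {b} {k} a+b≡2n eq (inj₁ refl) = a≡n , trans (sym a≡b) a≡n , refl
    where
    a≡b : a ≡ b
    a≡b = ℕP.+-cancelʳ-≡ (3 * k) _ _ eq
    a≡n : a ≡ n
    a≡n = ℕP.*-cancelˡ-≡ _ _ 2 (trans (cong (a +_) (trans (ℕP.+-identityʳ a) a≡b)) a+b≡2n)
  balanced {n} {a} {b} {l = l} a+b≡2n eq (inj₂ refl) =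
    contradiction (trans (sym a+b≡2n) (trans (cong (_+ b) a≡b+3) (arith₂ b))) (ℕP.even≢odd n (suc b))
    where
    arith₁ : ∀ b l → b + 3 * suc l ≡ (b + 3) + 3 * l
    arith₁ = solve-∀
    arith₂ : ∀ b → (b + 3) + b ≡ suc (2 * suc b)
    arith₂ = solve-∀
    a≡b+3 : a ≡ b + 3
    a≡b+3 = ℕP.+-cancelʳ-≡ (3 * l) _ _ (trans eq (arith₁ b l))

  module _ {n : ℕ} {w : Path} (onAxis : ZigzagOnXAxis (2 * n) w) where
    private
      sums : sum (ups w) + sum (downs w) ≡ 2 * n
      sums = ℤP.+-injective (trans (sym (size-ups-downs w)) (proj₁ (proj₂ onAxis)))

      heights : sum (ups w) + 3 * length (downs w) ≡ sum (downs w) + 3 * length (ups w)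
      heights = ℤP.+-injective (trans (sym (ℤP.+-identityˡ _))
        (trans (cong (λ y → y ℤ.+ ℤ.+ (sum (ups w) + 3 * length (downs w))) (sym (proj₂ (proj₂ onAxis))))
               (height-ups-downs w)))

      compositionPair : sum (ups w) ≡ n × sum (downs w) ≡ n × length (ups w) ≡ length (downs w) →
                        CompositionPair n (split w)
      compositionPair (sX , sY , l) =
        ((1or2-positive (1or2-ups w) , sX) , 1or2-ups w) ,
        ((1or2-positive (1or2-downs w) , sY) , 1or2-downs w) , l

    ZigzagOnXAxis⇒CompositionPair :
      CompositionPair n (split w) × (uncurry upFirst (split w) ≡ w ⊎ uncurry downFirst (split w) ≡ w)
    ZigzagOnXAxis⇒CompositionPair with zigzag-starts w
    ... | inj₁ u with eq , l ← upFirst-ups-downs (proj₁ onAxis) u =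
      compositionPair (balanced sums heights l) , inj₁ eq
    ... | inj₂ d with eq , l ← downFirst-ups-downs (proj₁ onAxis) d
        with sY , sX , l≡ ← balanced (trans (ℕP.+-comm (sum (downs w)) _) sums) (sym heights) l =
      compositionPair (sX , sY , sym l≡) , inj₂ eq

  -- A left inverse on the list itself is all that can be asked for: `upFirst` and `downFirst` are
  -- not injective on arbitrary pairs, since they drop surplus parts.
  map-unique : ∀ {A B : Set} (f : A → B) (g : B → A) {xs} →
               (∀ {x} → x ∈ xs → g (f x) ≡ x) → Unique xs → Unique (map f xs)
  map-unique f g {xs} g∘f u = AllPairs.map (λ gx≢gy x≡y → gx≢gy (cong g x≡y))
    (AllPairsP.map⁻ (subst Unique (sym g∘f-map) u))
    where
    g∘f-map : map g (map f xs) ≡ xs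
    g∘f-map = trans (sym (ListP.map-∘ xs)) (ListP.map-id-local (All.tabulate g∘f))

  compositionPair⇒upFirst : ∀ {n X Y} → CompositionPair n (X , Y) → Splits (upFirst X Y) X Y
  compositionPair⇒upFirst ((_ , p) , (_ , q) , l) = upFirst-splits p q (inj₁ l)

  compositionPair⇒downFirst : ∀ {n X Y} → CompositionPair n (X , Y) → Splits (downFirst X Y) X Y
  compositionPair⇒downFirst ((_ , p) , (_ , q) , l) = downFirst-splits p q (inj₁ (sym l))

  -- A composition of a positive number has a first part, so one path begins with an up-step and the
  -- other with a down-step. For size 0 both interleavings are the empty path.
  upFirst≢downFirst : ∀ {n X Y X′ Y′} → CompositionPair (suc n) (X , Y) → CompositionPair (suc n) (X′ , Y′) →
                      upFirst X Y ≢ downFirst X′ Y′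
  upFirst≢downFirst ((_ , here refl ∷ _) , _) (_ , (_ , here refl ∷ _) , _) ()
  upFirst≢downFirst ((_ , here refl ∷ _) , _) (_ , (_ , there (here refl) ∷ _) , _) ()
  upFirst≢downFirst ((_ , there (here refl) ∷ _) , _) (_ , (_ , here refl ∷ _) , _) ()
  upFirst≢downFirst ((_ , there (here refl) ∷ _) , _) (_ , (_ , there (here refl) ∷ _) , _) ()
  upFirst≢downFirst (((_ , ()) , []) , _)
  upFirst≢downFirst ((_ , _ ∷ _) , _) (_ , ((_ , ()) , []) , _)

  module _ (n : ℕ) where
    private
      module PathList = Enumeration (paths (suc n))
      module PairList = Enumeration (compositionPairs (suc n))

      upPaths downPaths : List Path
      upPaths   = map (uncurry upFirst) PairList.elements
      downPaths = map (uncurry downFirst) PairList.elements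

      split-upFirst : ∀ {p} → p ∈ PairList.elements → split (uncurry upFirst p) ≡ p
      split-upFirst p∈ with s ← compositionPair⇒upFirst (PairList.sound p∈) =
        cong₂ _,_ (ups≡ s) (downs≡ s)

      split-downFirst : ∀ {p} → p ∈ PairList.elements → split (uncurry downFirst p) ≡ p
      split-downFirst p∈ with s ← compositionPair⇒downFirst (PairList.sound p∈) =
        cong₂ _,_ (ups≡ s) (downs≡ s)

      disjoint : ∀ {w} → ¬ (w ∈ upPaths × w ∈ downPaths)
      disjoint (w∈₁ , w∈₂)
        with _ , p∈ , refl ← ∈P.∈-map⁻ _ w∈₁ | _ , q∈ , eq ← ∈P.∈-map⁻ _ w∈₂ =
        upFirst≢downFirst (PairList.sound p∈) (PairList.sound q∈) eq

      ∈-paths⇒ : ∀ {w} → w ∈ PathList.elements → w ∈ upPaths ++ downPaths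
      ∈-paths⇒ {w} w∈ with ZigzagOnXAxis⇒CompositionPair {suc n} (PathList.sound w∈)
      ... | cp , inj₁ eq = ∈P.∈-++⁺ˡ
        (subst (_∈ upPaths) eq (∈P.∈-map⁺ (uncurry upFirst) (PairList.complete cp)))
      ... | cp , inj₂ eq = ∈P.∈-++⁺ʳ upPaths
        (subst (_∈ downPaths) eq (∈P.∈-map⁺ (uncurry downFirst) (PairList.complete cp)))

      ⇒∈-paths : ∀ {w} → w ∈ upPaths ++ downPaths → w ∈ PathList.elements
      ⇒∈-paths w∈ with ∈P.∈-++⁻ upPaths w∈
      ... | inj₁ w∈₁ with _ , p∈ , refl ← ∈P.∈-map⁻ _ w∈₁ = PathList.complete
        (Splits⇒ZigzagOnXAxis (PairList.sound p∈) (compositionPair⇒upFirst (PairList.sound p∈)))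
      ... | inj₂ w∈₂ with _ , p∈ , refl ← ∈P.∈-map⁻ _ w∈₂ = PathList.complete
        (Splits⇒ZigzagOnXAxis (PairList.sound p∈) (compositionPair⇒downFirst (PairList.sound p∈)))

    paths-↭ : PathList.elements ↭ upPaths ++ downPaths
    paths-↭ = unique∧set⇒↭ PathList.unique
      (UniqueP.++⁺ (map-unique _ split split-upFirst PairList.unique)
                   (map-unique _ split split-downFirst PairList.unique) disjoint)
      ∈-paths⇒ ⇒∈-paths

    private
      P = PairList.elements

      map-steps : (f : List ℕ × List ℕ → Path) → (∀ {p} → p ∈ P → split (f p) ≡ p) →
                  map steps (map f P) ≡ map parts P
      map-steps f eq = trans (sym (ListP.map-∘ P)) (ListP.map-cong-local
        (All.tabulate λ {p} p∈ → trans (steps-ups-downs (f p)) (cong parts (eq p∈))))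

    sum-steps : sum (map steps PathList.elements) ≡ 2 * sum (map parts P)
    sum-steps = begin
      sum (map steps PathList.elements)
        ≡⟨ sum-↭ (↭P.map⁺ steps paths-↭) ⟩
      sum (map steps (upPaths ++ downPaths))
        ≡⟨ cong sum (ListP.map-++ steps upPaths downPaths) ⟩
      sum (map steps upPaths ++ map steps downPaths)
        ≡⟨ sum-++ (map steps upPaths) _ ⟩
      sum (map steps upPaths) + sum (map steps downPaths)
        ≡⟨ cong₂ (λ xs ys → sum xs + sum ys) (map-steps _ split-upFirst) (map-steps _ split-downFirst) ⟩
      sum (map parts P) + sum (map parts P)
        ≡⟨ cong (sum (map parts P) +_) (ℕP.+-identityʳ _) ⟨
      2 * sum (map parts P) ∎
      where open ≡-Reasoning

    length-paths : length PathList.elements ≡ 2 * length P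
    length-paths = begin
      length PathList.elements          ≡⟨ ↭P.↭-length paths-↭ ⟩
      length (upPaths ++ downPaths)     ≡⟨ ListP.length-++ upPaths ⟩
      length upPaths + length downPaths ≡⟨ cong₂ _+_ (ListP.length-map _ P) (ListP.length-map _ P) ⟩
      length P + length P               ≡⟨ cong (length P +_) (ℕP.+-identityʳ _) ⟨
      2 * length P                      ∎
      where open ≡-Reasoning

  /-cong-× : ∀ {m n k l} .{{_ : ℕ.NonZero k}} .{{_ : ℕ.NonZero l}} → m * l ≡ n * k →
             (ℤ.+ m) ℚ./ k ≡ (ℤ.+ n) ℚ./ l
  /-cong-× {m} {n} {k@(suc _)} {l@(suc _)} eq = ℚP.fromℚᵘ-cong {ℚᵘ.mkℚᵘ (ℤ.+ m) _} {ℚᵘ.mkℚᵘ (ℤ.+ n) _}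
    (ℚᵘ.*≡* (trans (sym (ℤP.pos-* m l)) (trans (cong ℤ.+_ eq) (ℤP.pos-* n k))))

  expectation-scale : ∀ {A B : Set} {P : Pred A 0ℓ} {Q : Pred B 0ℓ} (e : Enumeration P) (e′ : Enumeration Q) {f g} c →
    sum (map f (elements e)) ≡ c * sum (map g (elements e′)) →
    length (elements e) ≡ c * length (elements e′) → expectation e f ≡ expectation e′ g
  expectation-scale e e′ {f} {g} c sums lengths =
    /-cong-× {sum (map f (elements e))} {sum (map g (elements e′))} {length (elements e)} {length (elements e′)}
      {{nonZero e}} {{nonZero e′}} (begin
      sum (map f (elements e)) * l  ≡⟨ cong (_* l) sums ⟩
      c * s * l                     ≡⟨ arith c s l ⟩
      s * (c * l)                   ≡⟨ cong (s *_) lengths ⟨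
      s * length (elements e)       ∎)
    where
    open ≡-Reasoning
    s = sum (map g (elements e′))
    l = length (elements e′)
    arith : ∀ c s l → c * s * l ≡ s * (c * l)
    arith = solve-∀

  expectedSteps≡expectedParts : ∀ n → expectedSteps n ≡ expectedParts n
  -- Here the correspondence is 1 : 1 instead of 2 : 1, between the empty path and the pair of empty
  -- compositions; both means compute to 0.
  expectedSteps≡expectedParts zero    = refl
  expectedSteps≡expectedParts (suc n) =
    expectation-scale (paths (suc n)) (compositionPairs (suc n)) 2 (sum-steps n) (length-paths n)

open ZigzagPaths using (expectedSteps≡expectedParts)

-- Squared binomials along z + 2 b = n: telescoping and the bound on the mean of u²

module DiagonalMoments where
  open import Data.Integer using (+_; _+_; _*_; _-_; -_; _≤_; 0ℤ; 1ℤ)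
  open import Data.Integer.Tactic.RingSolver using (solve-∀)
  import Data.Nat.Tactic.RingSolver as ℕS

  -- The two absorption identities need each other: after Pascal's rule, each induction step uses
  -- that `suc b * binomial a (suc b)` and `suc a * binomial (suc a) b` agree, which is both
  -- identities at `(a , b)`.
  binomial-absorbʳ : ∀ a b → suc b ℕ.* binomial a (suc b) ≡ suc (a ℕ.+ b) ℕ.* binomial a b
  binomial-absorbˡ : ∀ a b → suc a ℕ.* binomial (suc a) b ≡ suc (a ℕ.+ b) ℕ.* binomial a b

  binomial-absorbʳ zero    b = refl
  binomial-absorbʳ (suc a) b = begin
    suc b ℕ.* (binomial a (suc b) ℕ.+ binomial (suc a) b)
      ≡⟨ ℕP.*-distribˡ-+ (suc b) (binomial a (suc b)) _ ⟩
    suc b ℕ.* binomial a (suc b) ℕ.+ suc b ℕ.* binomial (suc a) b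
      ≡⟨ cong (ℕ._+ suc b ℕ.* binomial (suc a) b) (trans (binomial-absorbʳ a b) (sym (binomial-absorbˡ a b))) ⟩
    suc a ℕ.* binomial (suc a) b ℕ.+ suc b ℕ.* binomial (suc a) b
      ≡⟨ arith a b (binomial (suc a) b) ⟩
    suc (suc a ℕ.+ b) ℕ.* binomial (suc a) b ∎
    where
    open ≡-Reasoning
    arith : ∀ a b t → suc a ℕ.* t ℕ.+ suc b ℕ.* t ≡ suc (suc a ℕ.+ b) ℕ.* t
    arith = ℕS.solve-∀

  binomial-absorbˡ a zero    rewrite binomial-zeroʳ a | ℕP.+-identityʳ a = refl
  binomial-absorbˡ a (suc b) = begin
    suc a ℕ.* (binomial a (suc b) ℕ.+ binomial (suc a) b)
      ≡⟨ ℕP.*-distribˡ-+ (suc a) (binomial a (suc b)) _ ⟩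
    suc a ℕ.* binomial a (suc b) ℕ.+ suc a ℕ.* binomial (suc a) b
      ≡⟨ cong (suc a ℕ.* binomial a (suc b) ℕ.+_) (trans (binomial-absorbˡ a b) (sym (binomial-absorbʳ a b))) ⟩
    suc a ℕ.* binomial a (suc b) ℕ.+ suc b ℕ.* binomial a (suc b)
      ≡⟨ arith a b (binomial a (suc b)) ⟩
    suc (a ℕ.+ suc b) ℕ.* binomial a (suc b) ∎
    where
    open ≡-Reasoning
    arith : ∀ a b t → suc a ℕ.* t ℕ.+ suc b ℕ.* t ≡ suc (a ℕ.+ suc b) ℕ.* t
    arith = ℕS.solve-∀

  -- The recurrence along a diagonal, where a two is replaced by two ones. The passage goes through
  -- `binomial (suc a) b`, one absorption at a time.
  binomial-shift : ∀ a b → binomial a (suc b) ℕ.* (suc b ℕ.* (2 ℕ.+ a ℕ.+ b)) ≡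
                           binomial (2 ℕ.+ a) b ℕ.* ((2 ℕ.+ a) ℕ.* suc a)
  binomial-shift a b = begin
    binomial a (suc b) ℕ.* (suc b ℕ.* c)       ≡⟨ arith (binomial a (suc b)) (suc b) c ⟩
    c ℕ.* (suc b ℕ.* binomial a (suc b))       ≡⟨ cong (c ℕ.*_) (trans (binomial-absorbʳ a b) (sym (binomial-absorbˡ a b))) ⟩
    c ℕ.* (suc a ℕ.* binomial (suc a) b)       ≡⟨ arith′ c (suc a) (binomial (suc a) b) ⟩
    suc a ℕ.* (c ℕ.* binomial (suc a) b)       ≡⟨ cong (suc a ℕ.*_) (binomial-absorbˡ (suc a) b) ⟨
    suc a ℕ.* ((2 ℕ.+ a) ℕ.* binomial (2 ℕ.+ a) b) ≡⟨ arith″ (suc a) (2 ℕ.+ a) (binomial (2 ℕ.+ a) b) ⟩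
    binomial (2 ℕ.+ a) b ℕ.* ((2 ℕ.+ a) ℕ.* suc a) ∎
    where
    open ≡-Reasoning
    c = 2 ℕ.+ a ℕ.+ b
    arith : ∀ t x y → t ℕ.* (x ℕ.* y) ≡ y ℕ.* (x ℕ.* t)
    arith = ℕS.solve-∀
    arith′ : ∀ t x y → t ℕ.* (x ℕ.* y) ≡ x ℕ.* (t ℕ.* y)
    arith′ = ℕS.solve-∀
    arith″ : ∀ x y t → x ℕ.* (y ℕ.* t) ≡ t ℕ.* (y ℕ.* x)
    arith″ = ℕS.solve-∀

  *-distribˡ-sub : ∀ x y z → x * (y - z) ≡ x * y - x * z
  *-distribˡ-sub = solve-∀

  module _ {A : Set} where

    ∑ : (A → ℤ) → List A → ℤ
    ∑ f []       = 0ℤ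
    ∑ f (x ∷ xs) = f x + ∑ f xs

    ∑-cong : ∀ {f g} xs → (∀ {x} → x ∈ xs → f x ≡ g x) → ∑ f xs ≡ ∑ g xs
    ∑-cong []       eq = refl
    ∑-cong (x ∷ xs) eq = cong₂ _+_ (eq (here refl)) (∑-cong xs (λ x∈ → eq (there x∈)))

    ∑-mono : ∀ {f g} xs → (∀ {x} → x ∈ xs → f x ≤ g x) → ∑ f xs ≤ ∑ g xs
    ∑-mono []       le = ℤP.≤-refl
    ∑-mono (x ∷ xs) le = ℤP.+-mono-≤ (le (here refl)) (∑-mono xs (λ x∈ → le (there x∈)))

    ∑-+ : ∀ f g xs → ∑ (λ x → f x + g x) xs ≡ ∑ f xs + ∑ g xs
    ∑-+ f g []       = refl
    ∑-+ f g (x ∷ xs) = trans (cong (λ s → f x + g x + s) (∑-+ f g xs)) (arith (f x) (g x) _ _)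
      where
      arith : ∀ a b c d → a + b + (c + d) ≡ a + c + (b + d)
      arith = solve-∀

    ∑-sub : ∀ f g xs → ∑ (λ x → f x - g x) xs ≡ ∑ f xs - ∑ g xs
    ∑-sub f g []       = refl
    ∑-sub f g (x ∷ xs) = trans (cong (λ s → f x - g x + s) (∑-sub f g xs)) (arith (f x) (g x) _ _)
      where
      arith : ∀ a b c d → a - b + (c - d) ≡ a + c - (b + d)
      arith = solve-∀

    ∑-*ˡ : ∀ c f xs → ∑ (λ x → c * f x) xs ≡ c * ∑ f xs
    ∑-*ˡ c f []       = sym (ℤP.*-zeroʳ c)
    ∑-*ˡ c f (x ∷ xs) = trans (cong (λ s → c * f x + s) (∑-*ˡ c f xs)) (sym (ℤP.*-distribˡ-+ c (f x) _))

    ∑-nonneg : ∀ {f} xs → (∀ {x} → x ∈ xs → 0ℤ ≤ f x) → 0ℤ ≤ ∑ f xs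
    ∑-nonneg []       le = ℤP.≤-refl
    ∑-nonneg (x ∷ xs) le = ℤP.+-mono-≤ (le (here refl)) (∑-nonneg xs (λ x∈ → le (there x∈)))

  points : ℕ → ℕ → List (ℕ × ℕ)
  points zero          b = (0 , b) ∷ []
  points (suc zero)    b = (1 , b) ∷ []
  points (suc (suc a)) b = (suc (suc a) , b) ∷ points a (suc b)

  ∈-points : ∀ a b {a′ b′} → (a′ , b′) ∈ points a b → a′ ℕ.+ 2 ℕ.* b′ ≡ a ℕ.+ 2 ℕ.* b
  ∈-points zero          b (here refl) = refl
  ∈-points (suc zero)    b (here refl) = refl
  ∈-points (suc (suc a)) b (here refl) = refl
  ∈-points (suc (suc a)) b (there p∈)  = trans (∈-points a (suc b) p∈) (+-2*suc a b)

  -- At every point but the first, `g` takes the value of `h` at the preceding point; at the last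
  -- point the first coordinate is 0 or 1, and there `h` vanishes.
  ∑-points-shift : ∀ (g h : ℕ × ℕ → ℤ) → (∀ b → h (0 , b) ≡ 0ℤ) → (∀ b → h (1 , b) ≡ 0ℤ) →
    (∀ a b → g (a , suc b) ≡ h (suc (suc a) , b)) →
    ∀ a b → ∑ g (points a b) ≡ g (a , b) + ∑ h (points a b)
  ∑-points-shift g h h0 h1 gh zero       b = cong (λ i → g (0 , b) + (i + 0ℤ)) (sym (h0 b))
  ∑-points-shift g h h0 h1 gh (suc zero) b = cong (λ i → g (1 , b) + (i + 0ℤ)) (sym (h1 b))
  ∑-points-shift g h h0 h1 gh (suc (suc a)) b =
    cong (λ s → g (suc (suc a) , b) + s)
      (trans (∑-points-shift g h h0 h1 gh a (suc b)) (cong (λ s → s + ∑ h (points a (suc b))) (gh a b)))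

  sq : ℤ → ℤ
  sq x = x * x

  0≤sq : ∀ x → 0ℤ ≤ sq x
  0≤sq (+ n)      = subst (0ℤ ≤_) (ℤP.pos-* n n) (ℤ.+≤+ ℕ.z≤n)
  0≤sq ℤ.-[1+ n ] = ℤ.+≤+ ℕ.z≤n

  weight : ℕ × ℕ → ℤ
  weight (a , b) = + (binomial a b ℕ.* binomial a b)

  u : ℤ → ℤ → ℤ
  u n z = + 5 * sq z - sq n

  -- With z parts 1 and b parts 2, squaring binomial-shift gives
  -- weight (z , b) * sq (b * (z + b + 1)) = weight (z + 2 , b - 1) * sq ((z + 2) * (z + 1)).
  -- Multiplied by the test function u n z this telescopes along z + 2 b = n.
  G : ℤ → ℤ → ℤ → ℤ
  G n z b = u n z * sq (b * (z + b + 1ℤ)) - u n (z - + 2) * sq (z * (z - 1ℤ))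

  module _ (n : ℤ) where
    private
      G⁺ G⁻ : ℕ × ℕ → ℤ
      G⁺ (a , b) = weight (a , b) * (u n (+ a) * sq (+ b * (+ a + + b + 1ℤ)))
      G⁻ (a , b) = weight (a , b) * (u n (+ a - + 2) * sq (+ a * (+ a - 1ℤ)))

      G⁻-zero : ∀ b → G⁻ (0 , b) ≡ 0ℤ
      G⁻-zero b = trans (cong (weight (0 , b) *_) (ℤP.*-zeroʳ (u n (+ 0 - + 2)))) (ℤP.*-zeroʳ (weight (0 , b)))

      G⁻-one : ∀ b → G⁻ (1 , b) ≡ 0ℤ
      G⁻-one b = trans (cong (weight (1 , b) *_) (ℤP.*-zeroʳ (u n (+ 1 - + 2)))) (ℤP.*-zeroʳ (weight (1 , b)))

      square-out : ∀ t s v x → + s * x ≡ + t → + (s ℕ.* s) * (v * sq x) ≡ v * sq (+ t)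
      square-out t s v x eq = trans (cong (_* (v * sq x)) (ℤP.pos-* s s))
        (trans (arith (+ s) v x) (cong (λ y → v * sq y) eq))
        where
        arith : ∀ s v x → s * s * (v * (x * x)) ≡ v * (s * x * (s * x))
        arith = solve-∀

      G-shift : ∀ a b → G⁺ (a , suc b) ≡ G⁻ (suc (suc a) , b)
      G-shift a b = trans
        (square-out t (binomial a (suc b)) (u n (+ a)) (+ suc b * (+ a + + suc b + 1ℤ)) left)
        (sym (trans (square-out t (binomial (2 ℕ.+ a) b) (u n (+ (2 ℕ.+ a) - + 2)) (+ (2 ℕ.+ a) * (+ (2 ℕ.+ a) - 1ℤ)) right)
                    (cong (λ z → u n z * sq (+ t)) (cancel (+ a)))))
        where
        -- The common value of both sides of `binomial-shift`; either side of the goal is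
        -- `u n (+ a)` times its square.
        t = binomial a (suc b) ℕ.* (suc b ℕ.* (2 ℕ.+ a ℕ.+ b))
        cancel : ∀ z → + 2 + z - + 2 ≡ z
        cancel = solve-∀
        arith : ∀ a b → a ℕ.+ suc b ℕ.+ 1 ≡ 2 ℕ.+ a ℕ.+ b
        arith = ℕS.solve-∀
        pos-*₂ : ∀ x y z → + (x ℕ.* (y ℕ.* z)) ≡ + x * (+ y * + z)
        pos-*₂ x y z = trans (ℤP.pos-* x _) (cong (+ x *_) (ℤP.pos-* y z))
        left : + binomial a (suc b) * (+ suc b * (+ a + + suc b + 1ℤ)) ≡ + t
        left = trans (cong (λ k → + binomial a (suc b) * (+ suc b * + k)) (arith a b))
                     (sym (pos-*₂ (binomial a (suc b)) (suc b) _))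
        right : + binomial (2 ℕ.+ a) b * (+ (2 ℕ.+ a) * (+ (2 ℕ.+ a) - 1ℤ)) ≡ + t
        right = trans (sym (pos-*₂ (binomial (2 ℕ.+ a) b) (2 ℕ.+ a) (suc a))) (cong +_ (sym (binomial-shift a b)))

    -- After the shift only the value of `G⁺` at the first point `(m , 0)` survives, and its factor
    -- `b` is 0 there.
    ∑-weight-G : ∀ m → ∑ (λ (a , b) → weight (a , b) * G n (+ a) (+ b)) (points m 0) ≡ 0ℤ
    ∑-weight-G m = begin
      ∑ (λ (a , b) → weight (a , b) * G n (+ a) (+ b)) (points m 0)
        ≡⟨ ∑-cong (points m 0) (λ {(a , b)} _ → *-distribˡ-sub (weight (a , b))
             (u n (+ a) * sq (+ b * (+ a + + b + 1ℤ))) (u n (+ a - + 2) * sq (+ a * (+ a - 1ℤ)))) ⟩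
      ∑ (λ p → G⁺ p - G⁻ p) (points m 0)
        ≡⟨ ∑-sub G⁺ G⁻ (points m 0) ⟩
      ∑ G⁺ (points m 0) - ∑ G⁻ (points m 0)
        ≡⟨ cong (_- ∑ G⁻ (points m 0)) (∑-points-shift G⁺ G⁻ G⁻-zero G⁻-one G-shift m 0) ⟩
      G⁺ (m , 0) + ∑ G⁻ (points m 0) - ∑ G⁻ (points m 0)
        ≡⟨ arith (G⁺ (m , 0)) (∑ G⁻ (points m 0)) ⟩
      G⁺ (m , 0)
        ≡⟨ trans (cong (weight (m , 0) *_) (ℤP.*-zeroʳ (u n (+ m)))) (ℤP.*-zeroʳ (weight (m , 0))) ⟩
      0ℤ ∎
      where
      open ≡-Reasoning
      arith : ∀ x y → x + y - y ≡ x
      arith = solve-∀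

  -- For 2 b = n - z one has b (z + b) - z² = - u / 4 and b (z + b) + z² = (n² + 3 z²) / 4, so the
  -- leading part of 16 G is - u² (n² + 3 z²). The terms of lower degree are sorted by sign: the
  -- negative ones stand on the left as a nonnegative remainder, and the positive ones all carry a
  -- factor z².
  G-identity : ∀ z b → let n = z + + 2 * b in
    sq n * sq (u n z) + + 16 * G n z b + (+ 3 * (sq z * sq (u n z)) +
      (+ 128 * (b * b * b * b * b) + + 256 * (z * b * b * b * b) + + 128 * (z * z * z * z * b)
       + + 64 * (b * b * b * b) + + 64 * (z * (b * b * b)) + + 1024 * (z * z * z * z) + + 320 * (z * z)))
    ≡ z * z * (+ 448 * (z * z * z) + + 128 * (b * b) + + 64 * (z * b) + + 960 * z)
  G-identity = expanded
    where
    expanded : ∀ z b → let n = z + + 2 * b ; U = + 5 * (z * z) - n * n ; V = + 5 * ((z - + 2) * (z - + 2)) - n * n in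
      n * n * (U * U)
      + + 16 * (U * ((b * (z + b + 1ℤ)) * (b * (z + b + 1ℤ))) - V * (z * (z - 1ℤ) * (z * (z - 1ℤ))))
      + (+ 3 * (z * z * (U * U)) +
        (+ 128 * (b * b * b * b * b) + + 256 * (z * b * b * b * b) + + 128 * (z * z * z * z * b)
         + + 64 * (b * b * b * b) + + 64 * (z * (b * b * b)) + + 1024 * (z * z * z * z) + + 320 * (z * z)))
      ≡ z * z * (+ 448 * (z * z * z) + + 128 * (b * b) + + 64 * (z * b) + + 960 * z)
    expanded = solve-∀

  0≤+ : ∀ {x y} → 0ℤ ≤ x → 0ℤ ≤ y → 0ℤ ≤ x + y
  0≤+ = ℤP.+-mono-≤

  0≤* : ∀ {x y} → 0ℤ ≤ x → 0ℤ ≤ y → 0ℤ ≤ x * y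
  0≤* {+ m} {+ n} _ _ = subst (0ℤ ≤_) (ℤP.pos-* m n) (ℤ.+≤+ ℕ.z≤n)

  0≤pos : ∀ n → 0ℤ ≤ + n
  0≤pos n = ℤ.+≤+ ℕ.z≤n

  *-mono-≤ : ∀ {x y x′ y′} → 0ℤ ≤ x → x ≤ y → 0ℤ ≤ x′ → x′ ≤ y′ → x * x′ ≤ y * y′
  *-mono-≤ {+ a} {+ b} {+ a′} {+ b′} _ (ℤ.+≤+ a≤b) _ (ℤ.+≤+ a′≤b′) =
    subst₂ _≤_ (ℤP.pos-* a a′) (ℤP.pos-* b b′) (ℤ.+≤+ (ℕP.*-mono-≤ a≤b a′≤b′))

  x≤x+y : ∀ {x y} → 0ℤ ≤ y → x ≤ x + y
  x≤x+y {x} {y} 0≤y = subst (_≤ x + y) (ℤP.+-identityʳ x) (ℤP.+-monoʳ-≤ x 0≤y)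

  *-monoˡ : ∀ k {x y} → x ≤ y → + k * x ≤ + k * y
  *-monoˡ k = ℤP.*-monoˡ-≤-nonNeg (+ k)

  -- The remainder in `G-identity` is dropped. Since z and b are at most n and 1 ≤ n, each monomial
  -- of the bracket is at most n³, and 448 + 128 + 64 + 960 = 1600.
  G-bound : ∀ {z b} → 0ℤ ≤ z → 0ℤ ≤ b → let n = z + + 2 * b in 1ℤ ≤ n →
            sq n * sq (u n z) + + 16 * G n z b ≤ + 1600 * (sq n * (n * sq n))
  G-bound {z} {b} 0≤z 0≤b 1≤n = begin
    sq n * sq (u n z) + + 16 * G n z b
      ≤⟨ x≤x+y rest ⟩
    _ ≡⟨ G-identity z b ⟩
    z * z * (+ 448 * (z * z * z) + + 128 * (b * b) + + 64 * (z * b) + + 960 * z)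
      ≤⟨ *-mono-≤ (0≤sq z) (*-mono-≤ 0≤z z≤ 0≤z z≤) bracket-nonneg bracket-≤ ⟩
    sq n * (+ 448 * (n * n * n) + + 128 * (n * n * n) + + 64 * (n * n * n) + + 960 * (n * n * n))
      ≡⟨ arith n ⟩
    + 1600 * (sq n * (n * sq n)) ∎
    where
    open ℤP.≤-Reasoning
    n = z + + 2 * b
    arith : ∀ n → n * n * (+ 448 * (n * n * n) + + 128 * (n * n * n) + + 64 * (n * n * n) + + 960 * (n * n * n)) ≡
            + 1600 * (n * n * (n * (n * n)))
    arith = solve-∀
    infixl 6 _⊹_
    infixl 7 _·_
    _⊹_ = 0≤+
    _·_ = 0≤*
    k = 0≤pos
    z≤ : z ≤ n
    z≤ = x≤x+y (k 2 · 0≤b)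
    b≤n : b ≤ n
    b≤n = subst (b ≤_) (b+ z b) (x≤x+y (0≤b ⊹ 0≤z))
      where
      b+ : ∀ z b → b + (b + z) ≡ z + + 2 * b
      b+ = solve-∀
    rest : 0ℤ ≤ + 3 * (sq z * sq (u n z)) +
      (+ 128 * (b * b * b * b * b) + + 256 * (z * b * b * b * b) + + 128 * (z * z * z * z * b)
       + + 64 * (b * b * b * b) + + 64 * (z * (b * b * b)) + + 1024 * (z * z * z * z) + + 320 * (z * z))
    rest = k 3 · (0≤sq z · 0≤sq (u n z)) ⊹
      (k 128 · (0≤b · 0≤b · 0≤b · 0≤b · 0≤b) ⊹ k 256 · (0≤z · 0≤b · 0≤b · 0≤b · 0≤b) ⊹ k 128 · (0≤z · 0≤z · 0≤z · 0≤z · 0≤b)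
       ⊹ k 64 · (0≤b · 0≤b · 0≤b · 0≤b) ⊹ k 64 · (0≤z · (0≤b · 0≤b · 0≤b)) ⊹ k 1024 · (0≤z · 0≤z · 0≤z · 0≤z) ⊹ k 320 · (0≤z · 0≤z))
    bracket-nonneg : 0ℤ ≤ + 448 * (z * z * z) + + 128 * (b * b) + + 64 * (z * b) + + 960 * z
    bracket-nonneg = k 448 · (0≤z · 0≤z · 0≤z) ⊹ k 128 · (0≤b · 0≤b) ⊹ k 64 · (0≤z · 0≤b) ⊹ k 960 · 0≤z
    cube : ∀ {x y t} → 0ℤ ≤ x → x ≤ n → 0ℤ ≤ y → y ≤ n → 0ℤ ≤ t → t ≤ n → x * y * t ≤ n * n * n
    cube 0≤x x≤n 0≤y y≤n 0≤t t≤n = *-mono-≤ (0≤x · 0≤y) (*-mono-≤ 0≤x x≤n 0≤y y≤n) 0≤t t≤n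
    square : ∀ {x y} → 0ℤ ≤ x → x ≤ n → 0ℤ ≤ y → y ≤ n → x * y ≤ n * n * n
    square {x} {y} 0≤x x≤n 0≤y y≤n = subst (_≤ n * n * n) (ℤP.*-identityʳ (x * y)) (cube 0≤x x≤n 0≤y y≤n (k 1) 1≤n)
    bracket-≤ : + 448 * (z * z * z) + + 128 * (b * b) + + 64 * (z * b) + + 960 * z ≤
                + 448 * (n * n * n) + + 128 * (n * n * n) + + 64 * (n * n * n) + + 960 * (n * n * n)
    bracket-≤ = ℤP.+-mono-≤ (ℤP.+-mono-≤ (ℤP.+-mono-≤
      (*-monoˡ 448 (cube 0≤z z≤ 0≤z z≤ 0≤z z≤))
      (*-monoˡ 128 (square 0≤b b≤n 0≤b b≤n)))
      (*-monoˡ 64 (square 0≤z z≤ 0≤b b≤n)))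
      (*-monoˡ 960 (subst (_≤ n * n * n) (ℤP.*-identityʳ z) (square 0≤z z≤ (k 1) 1≤n)))

  -- Inequalities between weighted moments, from averaged squares

  module Moments {A : Set} (xs : List A) (w z : A → ℤ) (0≤w : ∀ x → 0ℤ ≤ w x) (0≤z : ∀ x → 0ℤ ≤ z x)
                 (n : ℤ) where

    -- The unnormalised mean: the total weight `W` is not divided out, which keeps all moments in ℤ.
    𝔼 : (ℤ → ℤ) → ℤ
    𝔼 f = ∑ (λ x → w x * f (z x)) xs

    W S₁ S₂ U₂ : ℤ
    W  = 𝔼 (λ _ → 1ℤ)
    S₁ = 𝔼 (λ z → z)
    S₂ = 𝔼 sq
    U₂ = 𝔼 (λ z → sq (u n z))

    𝔼-nonneg : ∀ {f} → (∀ {z} → 0ℤ ≤ z → 0ℤ ≤ f z) → 0ℤ ≤ 𝔼 f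
    𝔼-nonneg 0≤f = ∑-nonneg xs λ {x} _ → 0≤* (0≤w x) (0≤f (0≤z x))

    private
      𝔼-+ : ∀ f g → 𝔼 (λ z → f z + g z) ≡ 𝔼 f + 𝔼 g
      𝔼-+ f g = trans (∑-cong xs λ {x} _ → ℤP.*-distribˡ-+ (w x) (f (z x)) (g (z x)))
                      (∑-+ (λ x → w x * f (z x)) (λ x → w x * g (z x)) xs)

      𝔼-* : ∀ c f → 𝔼 (λ z → c * f z) ≡ c * 𝔼 f
      𝔼-* c f = trans (∑-cong xs λ {x} _ → arith (w x) c (f (z x))) (∑-*ˡ c (λ x → w x * f (z x)) xs)
        where
        arith : ∀ w c y → w * (c * y) ≡ c * (w * y)
        arith = solve-∀

    -- All functions averaged below lie in the span of 1, z, z² and u², so the average of a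
    -- nonnegative one becomes a linear inequality between four moments.
    𝔼-linear : ∀ c₀ c₁ c₂ c₃ {f} → (∀ z → f z ≡ c₀ * 1ℤ + c₁ * z + c₂ * sq z + c₃ * sq (u n z)) →
               𝔼 f ≡ c₀ * W + c₁ * S₁ + c₂ * S₂ + c₃ * U₂
    𝔼-linear c₀ c₁ c₂ c₃ {f} eq = begin
      𝔼 f
        ≡⟨ ∑-cong xs (λ {x} _ → cong (w x *_) (eq (z x))) ⟩
      𝔼 (λ z → c₀ * 1ℤ + c₁ * z + c₂ * sq z + c₃ * sq (u n z))
        ≡⟨ 𝔼-+ (λ z → c₀ * 1ℤ + c₁ * z + c₂ * sq z) (λ z → c₃ * sq (u n z)) ⟩
      𝔼 (λ z → c₀ * 1ℤ + c₁ * z + c₂ * sq z) + 𝔼 (λ z → c₃ * sq (u n z))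
        ≡⟨ cong₂ _+_ (𝔼-+ (λ z → c₀ * 1ℤ + c₁ * z) (λ z → c₂ * sq z)) (𝔼-* c₃ (λ z → sq (u n z))) ⟩
      𝔼 (λ z → c₀ * 1ℤ + c₁ * z) + 𝔼 (λ z → c₂ * sq z) + c₃ * U₂
        ≡⟨ cong (_+ c₃ * U₂) (cong₂ _+_ (𝔼-+ (λ _ → c₀ * 1ℤ) (λ z → c₁ * z)) (𝔼-* c₂ sq)) ⟩
      𝔼 (λ _ → c₀ * 1ℤ) + 𝔼 (λ z → c₁ * z) + c₂ * S₂ + c₃ * U₂
        ≡⟨ cong (λ s → s + c₂ * S₂ + c₃ * U₂) (cong₂ _+_ (𝔼-* c₀ (λ _ → 1ℤ)) (𝔼-* c₁ (λ z → z))) ⟩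
      c₀ * W + c₁ * S₁ + c₂ * S₂ + c₃ * U₂ ∎
      where open ≡-Reasoning

    module _ (M : ℤ) where
      private
        -- AM-GM for 5 M (z − y)² against n², using (5 (z − y)²)² ≤ (u n z − u n y)² for y, z ≥ 0.
        pair : ℤ → ℤ → ℤ
        pair y z = + 2 * sq M * (sq (u n z) + sq (u n y)) + sq (sq n) - + 10 * sq n * M * sq (z - y)

        -- With V = u n z and U = u n y, (V - U)² = 25 (z - y)² (z + y)² = 25 (z - y)⁴ + 100 z y (z
        -- - y)², and (V + U)² + (V - U)² = 2 (V² + U²).
        pair-squares : ∀ y z → sq (M * u n z + M * u n y) + sq (+ 5 * M * sq (z - y) - sq n)
                               + + 100 * (sq M * (z * y * sq (z - y))) ≡ pair y z
        pair-squares y z = expanded n M y z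
          where
          expanded : ∀ n M y z → let V = + 5 * (z * z) - n * n ; U = + 5 * (y * y) - n * n in
            (M * V + M * U) * (M * V + M * U) + (+ 5 * M * ((z - y) * (z - y)) - n * n) * (+ 5 * M * ((z - y) * (z - y)) - n * n)
              + + 100 * (M * M * (z * y * ((z - y) * (z - y)))) ≡
            + 2 * (M * M) * (V * V + U * U) + n * n * (n * n) - + 10 * (n * n) * M * ((z - y) * (z - y))
          expanded = solve-∀

        pair-nonneg : ∀ {y z} → 0ℤ ≤ y → 0ℤ ≤ z → 0ℤ ≤ pair y z
        pair-nonneg {y} {z} 0≤y 0≤z = subst (0ℤ ≤_) (pair-squares y z)
          (0≤+ (0≤+ (0≤sq (M * u n z + M * u n y)) (0≤sq (+ 5 * M * sq (z - y) - sq n)))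
               (0≤* (0≤pos 100) (0≤* (0≤sq M) (0≤* (0≤* 0≤z 0≤y) (0≤sq (z - y))))))

      -- The average of 2 M n² u ≤ M² u² + n⁴, with u = 5 z² - n² substituted in the linear term;
      -- `second-moment-≥` is the same with - u.
      second-moment-≤ : 0ℤ ≤ (sq (sq n) + + 2 * sq (sq n) * M) * W + 0ℤ * S₁ + (- (+ 10 * sq n * M)) * S₂ + sq M * U₂
      second-moment-≤ = subst (0ℤ ≤_) (𝔼-linear (sq (sq n) + + 2 * sq (sq n) * M) 0ℤ (- (+ 10 * sq n * M)) (sq M) (λ z → expanded n M z))
        (𝔼-nonneg λ {z} _ → 0≤sq (M * u n z - sq n))
        where
        expanded : ∀ n M z → let U = + 5 * (z * z) - n * n in (M * U - n * n) * (M * U - n * n) ≡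
          (n * n * (n * n) + + 2 * (n * n * (n * n)) * M) * 1ℤ + 0ℤ * z + (- (+ 10 * (n * n) * M)) * (z * z) + M * M * (U * U)
        expanded = solve-∀

      second-moment-≥ : 0ℤ ≤ (sq (sq n) - + 2 * sq (sq n) * M) * W + 0ℤ * S₁ + (+ 10 * sq n * M) * S₂ + sq M * U₂
      second-moment-≥ = subst (0ℤ ≤_) (𝔼-linear (sq (sq n) - + 2 * sq (sq n) * M) 0ℤ (+ 10 * sq n * M) (sq M) (λ z → expanded n M z))
        (𝔼-nonneg λ {z} _ → 0≤sq (M * u n z + sq n))
        where
        expanded : ∀ n M z → let U = + 5 * (z * z) - n * n in (M * U + n * n) * (M * U + n * n) ≡
          (n * n * (n * n) - + 2 * (n * n * (n * n)) * M) * 1ℤ + 0ℤ * z + (+ 10 * (n * n) * M) * (z * z) + M * M * (U * U)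
        expanded = solve-∀

      -- `pair` is averaged over z and then over an independent y; the double sum of (z - y)² is 2
      -- (W S₂ - S₁²).
      variance-≤ : 0ℤ ≤ sq (sq n) * sq W - + 20 * sq n * M * (W * S₂ - sq S₁) + + 4 * sq M * W * U₂
      variance-≤ = subst (0ℤ ≤_) (trans (𝔼-linear d₀ d₁ d₂ d₃ outer) (total n M W S₁ S₂ U₂))
        (𝔼-nonneg λ {y} 0≤y → subst (0ℤ ≤_) (𝔼-linear (c₀ y) (c₁ y) c₂ c₃ (inner y)) (𝔼-nonneg (pair-nonneg 0≤y)))
        where
        c₀ c₁ : ℤ → ℤ
        c₂ c₃ d₀ d₁ d₂ d₃ : ℤ
        -- The `c` are the coefficients of `pair y z` with respect to 1, z, z², u(z)², and the `d`
        -- those of its sum over z with respect to 1, y, y², u(y)².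
        c₀ y = + 2 * sq M * sq (u n y) + sq (sq n) - + 10 * sq n * M * sq y
        c₁ y = + 20 * sq n * M * y
        c₂ = - (+ 10 * sq n * M)
        c₃ = + 2 * sq M
        d₀ = sq (sq n) * W - + 10 * sq n * M * S₂ + + 2 * sq M * U₂
        d₁ = + 20 * sq n * M * S₁
        d₂ = - (+ 10 * sq n * M * W)
        d₃ = + 2 * sq M * W

        inner : ∀ y z → pair y z ≡ c₀ y * 1ℤ + c₁ y * z + c₂ * sq z + c₃ * sq (u n z)
        inner y z = expanded n M y z (u n y) (u n z)
          where
          expanded : ∀ n M y z U V →
            + 2 * (M * M) * (V * V + U * U) + n * n * (n * n) - + 10 * (n * n) * M * ((z - y) * (z - y)) ≡
            (+ 2 * (M * M) * (U * U) + n * n * (n * n) - + 10 * (n * n) * M * (y * y)) * 1ℤ + (+ 20 * (n * n) * M * y) * z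
              + (- (+ 10 * (n * n) * M)) * (z * z) + + 2 * (M * M) * (V * V)
          expanded = solve-∀

        outer : ∀ y → c₀ y * W + c₁ y * S₁ + c₂ * S₂ + c₃ * U₂ ≡ d₀ * 1ℤ + d₁ * y + d₂ * sq y + d₃ * sq (u n y)
        outer y = expanded n M y (u n y) W S₁ S₂ U₂
          where
          expanded : ∀ n M y U W S₁ S₂ U₂ →
            (+ 2 * (M * M) * (U * U) + n * n * (n * n) - + 10 * (n * n) * M * (y * y)) * W + (+ 20 * (n * n) * M * y) * S₁
              + (- (+ 10 * (n * n) * M)) * S₂ + + 2 * (M * M) * U₂ ≡
            (n * n * (n * n) * W - + 10 * (n * n) * M * S₂ + + 2 * (M * M) * U₂) * 1ℤ + (+ 20 * (n * n) * M * S₁) * y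
              + (- (+ 10 * (n * n) * M * W)) * (y * y) + (+ 2 * (M * M) * W) * (U * U)
          expanded = solve-∀

        total : ∀ n M W S₁ S₂ U₂ →
            (n * n * (n * n) * W - + 10 * (n * n) * M * S₂ + + 2 * (M * M) * U₂) * W + (+ 20 * (n * n) * M * S₁) * S₁
              + (- (+ 10 * (n * n) * M * W)) * S₂ + (+ 2 * (M * M) * W) * U₂ ≡
            n * n * (n * n) * (W * W) - + 20 * (n * n) * M * (W * S₂ - S₁ * S₁) + + 4 * (M * M) * W * U₂
        total = solve-∀

    -- Cauchy-Schwarz, from averaging (W z - S₁)². The expansion leaves a surplus factor `W`, which
    -- `mean-≤` cancels.
    variance-nonneg : 0ℤ ≤ W * (W * S₂ - sq S₁)
    variance-nonneg = subst (0ℤ ≤_)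
      (trans (𝔼-linear (sq S₁) (- (+ 2 * W * S₁)) (sq W) 0ℤ (λ z → expanded W S₁ z (u n z))) (total W S₁ S₂ U₂))
      (𝔼-nonneg λ {z} _ → 0≤sq (W * z - S₁))
      where
      expanded : ∀ W S₁ z U → (W * z - S₁) * (W * z - S₁) ≡
        S₁ * S₁ * 1ℤ + (- (+ 2 * W * S₁)) * z + W * W * (z * z) + 0ℤ * (U * U)
      expanded = solve-∀
      total : ∀ W S₁ S₂ U₂ → S₁ * S₁ * W + (- (+ 2 * W * S₁)) * S₁ + W * W * S₂ + 0ℤ * U₂ ≡ W * (W * S₂ - S₁ * S₁)
      total = solve-∀

  -- Concentration of z around n / √5

  0≤-cancelˡ : ∀ {k x} → 1ℤ ≤ k → 0ℤ ≤ k * x → 0ℤ ≤ x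
  0≤-cancelˡ {+ suc k} {x} _ 0≤kx =
    ℤP.*-cancelˡ-≤-pos 0ℤ x (+ suc k) (subst (_≤ + suc k * x) (sym (ℤP.*-zeroʳ (+ suc k))) 0≤kx)
  0≤-cancelˡ {+ 0} (ℤ.+≤+ ())

  1≤* : ∀ {x y} → 1ℤ ≤ x → 1ℤ ≤ y → 1ℤ ≤ x * y
  1≤* 1≤x 1≤y = *-mono-≤ (0≤pos 1) 1≤x (0≤pos 1) 1≤y

  -- The factor 6400 = 4 · 1600 absorbs the term 4 M² W U₂ of the variance bound.
  module Concentration
    {n M W S₁ S₂ U₂ : ℤ} (1≤n : 1ℤ ≤ n) (0≤M : 0ℤ ≤ M) (1≤W : 1ℤ ≤ W)
    (fourth  : sq n * U₂ ≤ + 1600 * (sq n * (n * sq n)) * W)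
    (M-small : + 6400 * sq M ≤ n)
    (second-≤ : 0ℤ ≤ (sq (sq n) + + 2 * sq (sq n) * M) * W + 0ℤ * S₁ + (- (+ 10 * sq n * M)) * S₂ + sq M * U₂)
    (second-≥ : 0ℤ ≤ (sq (sq n) - + 2 * sq (sq n) * M) * W + 0ℤ * S₁ + (+ 10 * sq n * M) * S₂ + sq M * U₂)
    (variance : 0ℤ ≤ sq (sq n) * sq W - + 20 * sq n * M * (W * S₂ - sq S₁) + + 4 * sq M * W * U₂)
    (cauchy   : 0ℤ ≤ W * (W * S₂ - sq S₁))
    where
    private
      0≤n : 0ℤ ≤ n
      0≤n = ℤP.≤-trans (0≤pos 1) 1≤n
      0≤W : 0ℤ ≤ W
      0≤W = ℤP.≤-trans (0≤pos 1) 1≤W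
      0≤n⁵ : 0ℤ ≤ sq n * (n * sq n)
      0≤n⁵ = 0≤* (0≤sq n) (0≤* 0≤n (0≤sq n))
      1≤2n⁴ : 1ℤ ≤ + 2 * sq (sq n)
      1≤2n⁴ = 1≤* {+ 2} (ℤ.+≤+ (ℕ.s≤s ℕ.z≤n)) (1≤* (1≤* 1≤n 1≤n) (1≤* 1≤n 1≤n))
      fourth′ : 0ℤ ≤ + 1600 * (sq n * (n * sq n)) * W - sq n * U₂
      fourth′ = ℤP.i≤j⇒0≤j-i fourth
      M-small′ : 0ℤ ≤ sq n - + 6400 * (sq M * n)
      M-small′ = subst (0ℤ ≤_) (distrib n (sq M)) (0≤* (ℤP.i≤j⇒0≤j-i M-small) 0≤n)
        where
        distrib : ∀ n μ → (n - + 6400 * μ) * n ≡ n * n - + 6400 * (μ * n)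
        distrib = solve-∀

      -- Dividing by 5 M W shows the meaning: E z² exceeds n² / 5 by a factor of at most 1 + 1 / M.
      -- Here M² U₂ costs only 1600 of the 6400 in `M-small`; the term with 4800 = 6400 - 1600 makes
      -- up the difference in the identity.
      S₂-≤ : 0ℤ ≤ (M + 1ℤ) * (sq n * W) - + 5 * M * S₂
      S₂-≤ = 0≤-cancelˡ 1≤2n⁴ (subst (0ℤ ≤_) (identity n (sq n) M (sq M) W S₁ S₂ U₂)
        (0≤+ (0≤+ (0≤+ (0≤* (0≤sq n) second-≤) (0≤* (0≤sq M) fourth′)) (0≤* (0≤* (0≤sq (sq n)) 0≤W) M-small′))
             (0≤* (0≤pos 4800) (0≤* (0≤sq M) (0≤* 0≤n⁵ 0≤W)))))
        where
        identity : ∀ n q M μ W S₁ S₂ U₂ →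
          q * ((q * q + + 2 * (q * q) * M) * W + 0ℤ * S₁ + (- (+ 10 * q * M)) * S₂ + μ * U₂)
            + μ * (+ 1600 * (q * (n * q)) * W - q * U₂)
            + q * q * W * (q - + 6400 * (μ * n))
            + + 4800 * (μ * (q * (n * q) * W))
          ≡ + 2 * (q * q) * ((M + 1ℤ) * (q * W) - + 5 * M * S₂)
        identity = solve-∀

      S₂-≥ : 0ℤ ≤ + 5 * M * S₂ - (M - 1ℤ) * (sq n * W)
      S₂-≥ = 0≤-cancelˡ 1≤2n⁴ (subst (0ℤ ≤_) (identity n (sq n) M (sq M) W S₁ S₂ U₂)
        (0≤+ (0≤+ (0≤+ (0≤* (0≤sq n) second-≥) (0≤* (0≤sq M) fourth′)) (0≤* (0≤* (0≤sq (sq n)) 0≤W) M-small′))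
             (0≤* (0≤pos 4800) (0≤* (0≤sq M) (0≤* 0≤n⁵ 0≤W)))))
        where
        identity : ∀ n q M μ W S₁ S₂ U₂ →
          q * ((q * q - + 2 * (q * q) * M) * W + 0ℤ * S₁ + (+ 10 * q * M) * S₂ + μ * U₂)
            + μ * (+ 1600 * (q * (n * q)) * W - q * U₂)
            + q * q * W * (q - + 6400 * (μ * n))
            + + 4800 * (μ * (q * (n * q) * W))
          ≡ + 2 * (q * q) * (+ 5 * M * S₂ - (M - 1ℤ) * (q * W))
        identity = solve-∀

      variance-small : 0ℤ ≤ sq n * sq W - + 10 * M * (W * S₂ - sq S₁)
      variance-small = 0≤-cancelˡ 1≤2n⁴ (subst (0ℤ ≤_) (identity n (sq n) M (sq M) W S₁ S₂ U₂)
        (0≤+ (0≤+ (0≤* (0≤sq n) variance) (0≤* (0≤* (0≤* (0≤pos 4) (0≤sq M)) 0≤W) fourth′))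
             (0≤* (0≤* (0≤sq (sq n)) (0≤sq W)) M-small′)))
        where
        identity : ∀ n q M μ W S₁ S₂ U₂ →
          q * (q * q * (W * W) - + 20 * q * M * (W * S₂ - S₁ * S₁) + + 4 * μ * W * U₂)
            + + 4 * μ * W * (+ 1600 * (q * (n * q)) * W - q * U₂)
            + q * q * (W * W) * (q - + 6400 * (μ * n))
          ≡ + 2 * (q * q) * (q * (W * W) - + 10 * M * (W * S₂ - S₁ * S₁))
        identity = solve-∀

    mean-≤ : + 5 * M * sq S₁ ≤ (M + 1ℤ) * (sq n * sq W)
    mean-≤ = ℤP.0≤i-j⇒j≤i (subst (0ℤ ≤_) (identity n M W S₁ S₂)
      (0≤+ (0≤* 0≤W S₂-≤) (0≤* (0≤* (0≤pos 5) 0≤M) (0≤-cancelˡ 1≤W cauchy))))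
      where
      identity : ∀ n M W S₁ S₂ →
        W * ((M + 1ℤ) * (n * n * W) - + 5 * M * S₂) + + 5 * M * (W * S₂ - S₁ * S₁) ≡
        (M + 1ℤ) * (n * n * (W * W)) - + 5 * M * (S₁ * S₁)
      identity = solve-∀

    -- The lower bound on S₂ minus the variance. The constant 3 is made of 2 from `S₂-≥`, which
    -- enters doubled, and 1 from `variance-small`.
    mean-≥ : + 2 * M * (sq n * sq W) ≤ + 10 * M * sq S₁ + + 3 * (sq n * sq W)
    mean-≥ = ℤP.0≤i-j⇒j≤i (subst (0ℤ ≤_) (identity n M W S₁ S₂)
      (0≤+ (0≤* (0≤* (0≤pos 2) 0≤W) S₂-≥) variance-small))
      where
      identity : ∀ n M W S₁ S₂ →
        + 2 * W * (+ 5 * M * S₂ - (M - 1ℤ) * (n * n * W)) + (n * n * (W * W) - + 10 * M * (W * S₂ - S₁ * S₁)) ≡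
        + 10 * M * (S₁ * S₁) + + 3 * (n * n * (W * W)) - + 2 * M * (n * n * (W * W))
      identity = solve-∀

  onesOf : ℕ × ℕ → ℤ
  onesOf (a , _) = + a

  0≤weight : ∀ p → 0ℤ ≤ weight p
  0≤weight (a , b) = 0≤pos (binomial a b ℕ.* binomial a b)

  0≤onesOf : ∀ p → 0ℤ ≤ onesOf p
  0≤onesOf (a , _) = 0≤pos a

  module Diagonal (m : ℕ) (1≤m : 1 ℕ.≤ m) where
    private
      ps = points m 0
      n = + m

    open Moments ps weight onesOf 0≤weight 0≤onesOf n public

    private
      on-diagonal : ∀ {a b} → (a , b) ∈ ps → n ≡ + a + + 2 * + b
      on-diagonal {a} {b} p∈ = trans (cong +_ (trans (sym (ℕP.+-identityʳ m)) (sym (∈-points m 0 p∈))))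
        (trans (ℤP.pos-+ a (2 ℕ.* b)) (cong (λ c → + a + c) (ℤP.pos-* 2 b)))

      pointwise : ∀ {p} → p ∈ ps → let (a , b) = p in
        weight p * (sq n * sq (u n (+ a)) + + 16 * G n (+ a) (+ b)) ≤ weight p * (+ 1600 * (sq n * (n * sq n)))
      pointwise {a , b} p∈ = ℤP.*-monoˡ-≤-nonNeg (weight (a , b))
        (subst (λ k → sq k * sq (u k (+ a)) + + 16 * G k (+ a) (+ b) ≤ + 1600 * (sq k * (k * sq k))) (sym (on-diagonal p∈))
          (G-bound (0≤pos a) (0≤pos b) (subst (1ℤ ≤_) (on-diagonal p∈) (ℤ.+≤+ 1≤m))))

    -- `G-bound` summed with the weights; the sum of the `G` terms is 0. Divided by n² W, it says
    -- that the mean of u² is at most 1600 n³.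
    fourth : sq n * U₂ ≤ + 1600 * (sq n * (n * sq n)) * W
    fourth = begin
      sq n * U₂
        ≡⟨ ℤP.+-identityʳ (sq n * U₂) ⟨
      sq n * U₂ + + 16 * 0ℤ
        ≡⟨ cong (λ s → sq n * U₂ + + 16 * s) (∑-weight-G n m) ⟨
      sq n * U₂ + + 16 * ∑ f ps
        ≡⟨ cong₂ _+_ (∑-*ˡ (sq n) g ps) (∑-*ˡ (+ 16) f ps) ⟨
      ∑ (λ p → sq n * g p) ps + ∑ (λ p → + 16 * f p) ps
        ≡⟨ ∑-+ (λ p → sq n * g p) (λ p → + 16 * f p) ps ⟨
      ∑ (λ p → sq n * g p + + 16 * f p) ps
        ≡⟨ ∑-cong ps (λ {(a , b)} _ → arith (sq n) (weight (a , b)) (sq (u n (+ a))) (G n (+ a) (+ b))) ⟩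
      ∑ (λ (a , b) → weight (a , b) * (sq n * sq (u n (+ a)) + + 16 * G n (+ a) (+ b))) ps
        ≤⟨ ∑-mono ps pointwise ⟩
      ∑ (λ p → weight p * (+ 1600 * (sq n * (n * sq n)))) ps
        ≡⟨ ∑-cong ps (λ {p} _ → arith′ (weight p) (+ 1600 * (sq n * (n * sq n)))) ⟩
      ∑ (λ p → + 1600 * (sq n * (n * sq n)) * (weight p * 1ℤ)) ps
        ≡⟨ ∑-*ˡ (+ 1600 * (sq n * (n * sq n))) (λ p → weight p * 1ℤ) ps ⟩
      + 1600 * (sq n * (n * sq n)) * W ∎
      where
      open ℤP.≤-Reasoning
      f g : ℕ × ℕ → ℤ
      f (a , b) = weight (a , b) * G n (+ a) (+ b)
      g (a , b) = weight (a , b) * sq (u n (+ a))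
      arith : ∀ k w v g → k * (w * v) + + 16 * (w * g) ≡ w * (k * v + + 16 * g)
      arith = solve-∀
      arith′ : ∀ w k → w * k ≡ k * (w * 1ℤ)
      arith′ = solve-∀

open DiagonalMoments using (∑; points; weight; sq; 0≤pos; module Diagonal; module Concentration)

-- Signs in ℚ(√5), and from bounds on the squared mean to closeness to the limit

module QuadraticField where
  open import Defs
  open import Data.Rational using (_+_; _*_; _-_; -_)
  open import Tactic.RingSolver using (solve-∀)
  import Data.Nat.Tactic.RingSolver as ℕS

  ℚ-ring : AlmostCommutativeRing 0ℓ 0ℓ
  ℚ-ring = fromCommutativeRing ℚP.+-*-commutativeRing λ x → dec⇒maybe (0ℚ ℚP.≟ x)

  ⅒ ⅕ 2ℚ 3ℚ 5ℚ 8ℚ 10ℚ 20ℚ : ℚ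
  ⅒   = (ℤ.+ 1) ℚ./ 10
  ⅕   = (ℤ.+ 1) ℚ./ 5
  2ℚ  = (ℤ.+ 2) ℚ./ 1
  3ℚ  = (ℤ.+ 3) ℚ./ 1
  5ℚ  = (ℤ.+ 5) ℚ./ 1
  8ℚ  = (ℤ.+ 8) ℚ./ 1
  10ℚ = (ℤ.+ 10) ℚ./ 1
  20ℚ = (ℤ.+ 20) ℚ./ 1

  prime-5 : Prime 5
  prime-5 = from-yes (prime? 5)

  -- Infinite descent: 5 divides x, say x = 5 k, and then y² = 5 k² with y < x. So y = 0, which is
  -- impossible for x > 0.
  square≡5*square⇒0 : ∀ x y → x ℕ.* x ≡ 5 ℕ.* (y ℕ.* y) → x ≡ 0
  square≡5*square⇒0 = <-rec _ descend
    where
    descend : ∀ x → (∀ {y} → y ℕ.< x → ∀ z → y ℕ.* y ≡ 5 ℕ.* (z ℕ.* z) → y ≡ 0) →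
              ∀ y → x ℕ.* x ≡ 5 ℕ.* (y ℕ.* y) → x ≡ 0
    descend zero        rec y eq = refl
    descend x@(suc _) rec y eq with reduce (euclidsLemma x x prime-5 (divides (y ℕ.* y) (trans eq (ℕP.*-comm 5 (y ℕ.* y)))))
    ... | divides k x≡k5 = contradiction (rec y<x k y²≡5k²) y≢0
      where
      y≢0 : y ≢ 0
      y≢0 y≡0 = ℕP.1+n≢0 (trans eq (cong (λ z → 5 ℕ.* (z ℕ.* z)) y≡0))
      y<x : y ℕ.< x
      y<x = ℕP.≰⇒> λ x≤y → ℕP.<⇒≢ (ℕP.≤-<-trans (ℕP.*-mono-≤ x≤y x≤y)
        (ℕP.m<m*n (y ℕ.* y) 5 {{ℕP.m*n≢0 y y {{ℕ.≢-nonZero y≢0}} {{ℕ.≢-nonZero y≢0}}}} (ℕ.s≤s (ℕ.s≤s ℕ.z≤n))))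
        (trans eq (ℕP.*-comm 5 (y ℕ.* y)))
      arith : ∀ k → (k ℕ.* 5) ℕ.* (k ℕ.* 5) ≡ 5 ℕ.* (5 ℕ.* (k ℕ.* k))
      arith = ℕS.solve-∀
      y²≡5k² : y ℕ.* y ≡ 5 ℕ.* (k ℕ.* k)
      y²≡5k² = ℕP.*-cancelˡ-≡ _ _ 5 (trans (sym eq) (trans (cong₂ ℕ._*_ x≡k5 x≡k5) (arith k)))

  √5-irrational : ∀ a b → a * a ≡ 5ℚ * (b * b) → a ≡ 0ℚ
  √5-irrational a@record{} b@record{} eq = ℚP.↥p≡0⇒p≡0 a (ℤP.∣i∣≡0⇒i≡0 (numerator-zero
    (square≡5*square⇒0 (n ℕ.* e) (m ℕ.* d) squares)))
    where
    n = ℤ.∣ ℚ.↥ a ∣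
    m = ℤ.∣ ℚ.↥ b ∣
    d = ℚ.↧ₙ a
    e = ℚ.↧ₙ b
    cross : ℚ.toℚᵘ a ℚᵘ.* ℚ.toℚᵘ a ℚᵘ.≃ ℚ.toℚᵘ 5ℚ ℚᵘ.* (ℚ.toℚᵘ b ℚᵘ.* ℚ.toℚᵘ b)
    cross = begin
      ℚ.toℚᵘ a ℚᵘ.* ℚ.toℚᵘ a                        ≈⟨ ℚP.toℚᵘ-homo-* a a ⟨
      ℚ.toℚᵘ (a * a)                                ≡⟨ cong ℚ.toℚᵘ eq ⟩
      ℚ.toℚᵘ (5ℚ * (b * b))                         ≈⟨ ℚP.toℚᵘ-homo-* 5ℚ (b * b) ⟩
      ℚ.toℚᵘ 5ℚ ℚᵘ.* ℚ.toℚᵘ (b * b)                 ≈⟨ ℚᵘP.*-congˡ {ℚ.toℚᵘ 5ℚ} (ℚP.toℚᵘ-homo-* b b) ⟩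
      ℚ.toℚᵘ 5ℚ ℚᵘ.* (ℚ.toℚᵘ b ℚᵘ.* ℚ.toℚᵘ b)       ∎
      where open import Relation.Binary.Reasoning.Setoid ℚᵘP.≃-setoid
    squares : (n ℕ.* e) ℕ.* (n ℕ.* e) ≡ 5 ℕ.* ((m ℕ.* d) ℕ.* (m ℕ.* d))
    squares = begin
      (n ℕ.* e) ℕ.* (n ℕ.* e)                     ≡⟨ arith n e ⟩
      n ℕ.* n ℕ.* (1 ℕ.* (e ℕ.* e))
        ≡⟨ trans (ℤP.abs-* (ℚ.↥ a ℤ.* ℚ.↥ a) (ℤ.+ (1 ℕ.* (e ℕ.* e)))) (cong (ℕ._* (1 ℕ.* (e ℕ.* e))) (ℤP.abs-* (ℚ.↥ a) (ℚ.↥ a))) ⟨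
      ℤ.∣ ℚ.↥ a ℤ.* ℚ.↥ a ℤ.* ℤ.+ (1 ℕ.* (e ℕ.* e)) ∣
        ≡⟨ cong ℤ.∣_∣ (drop cross) ⟩
      ℤ.∣ ℤ.+ 5 ℤ.* (ℚ.↥ b ℤ.* ℚ.↥ b) ℤ.* ℤ.+ (d ℕ.* d) ∣
        ≡⟨ trans (ℤP.abs-* (ℤ.+ 5 ℤ.* (ℚ.↥ b ℤ.* ℚ.↥ b)) (ℤ.+ (d ℕ.* d)))
             (cong (ℕ._* (d ℕ.* d)) (trans (ℤP.abs-* (ℤ.+ 5) (ℚ.↥ b ℤ.* ℚ.↥ b)) (cong (5 ℕ.*_) (ℤP.abs-* (ℚ.↥ b) (ℚ.↥ b))))) ⟩
      5 ℕ.* (m ℕ.* m) ℕ.* (d ℕ.* d)               ≡⟨ arith′ m d ⟩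
      5 ℕ.* ((m ℕ.* d) ℕ.* (m ℕ.* d))             ∎
      where
      open ≡-Reasoning
      drop : ∀ {p q} → p ℚᵘ.≃ q → ℚᵘ.↥ p ℤ.* ℚᵘ.↧ q ≡ ℚᵘ.↥ q ℤ.* ℚᵘ.↧ p
      drop (ℚᵘ.*≡* eq) = eq
      arith : ∀ n e → (n ℕ.* e) ℕ.* (n ℕ.* e) ≡ n ℕ.* n ℕ.* (1 ℕ.* (e ℕ.* e))
      arith = ℕS.solve-∀
      arith′ : ∀ m d → 5 ℕ.* (m ℕ.* m) ℕ.* (d ℕ.* d) ≡ 5 ℕ.* ((m ℕ.* d) ℕ.* (m ℕ.* d))
      arith′ = ℕS.solve-∀
    numerator-zero : n ℕ.* e ≡ 0 → n ≡ 0
    numerator-zero eq′ with ℕP.m*n≡0⇒m≡0∨n≡0 n eq′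
    ... | inj₁ n≡0 = n≡0
    ... | inj₂ ()

  0<+ : ∀ {x y} → 0ℚ ℚ.≤ x → 0ℚ ℚ.< y → 0ℚ ℚ.< x + y
  0<+ = ℚP.+-mono-≤-<

  0≤+ : ∀ {x y} → 0ℚ ℚ.≤ x → 0ℚ ℚ.≤ y → 0ℚ ℚ.≤ x + y
  0≤+ = ℚP.+-mono-≤

  0<* : ∀ {x y} → 0ℚ ℚ.< x → 0ℚ ℚ.< y → 0ℚ ℚ.< x * y
  0<* {x} {y} 0<x 0<y = ℚP.positive⁻¹ _ {{ℚP.pos*pos⇒pos x {{ℚ.positive 0<x}} y {{ℚ.positive 0<y}}}}

  0≤* : ∀ {x y} → 0ℚ ℚ.≤ x → 0ℚ ℚ.≤ y → 0ℚ ℚ.≤ x * y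
  0≤* {x} {y} 0≤x 0≤y =
    ℚP.nonNegative⁻¹ _ {{ℚP.nonNeg*nonNeg⇒nonNeg x {{ℚ.nonNegative 0≤x}} y {{ℚ.nonNegative 0≤y}}}}

  0<y-x⇒x<y : ∀ {x y} → 0ℚ ℚ.< y - x → x ℚ.< y
  0<y-x⇒x<y {x} {y} 0<y-x = subst₂ ℚ._<_ (ℚP.+-identityʳ x) (arith x y) (ℚP.+-monoʳ-< x 0<y-x)
    where
    arith : ∀ x y → x + (y - x) ≡ y
    arith = solve-∀ ℚ-ring

  x≤y⇒0≤y-x : ∀ {x y} → x ℚ.≤ y → 0ℚ ℚ.≤ y - x
  x≤y⇒0≤y-x {x} {y} x≤y = subst (ℚ._≤ y - x) (ℚP.+-inverseʳ x) (ℚP.+-monoˡ-≤ (- x) x≤y)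

  -- The sign of a + b √5 is decided by a² and 5 b², which differ because √5 is irrational.
  Positive-nonneg : ∀ {a b} → 0ℚ ℚ.≤ a → 0ℚ ℚ.< b → Positive (_+_√5 a b)
  Positive-nonneg {a} {b} 0≤a 0<b with ℚP.<-cmp (a * a) (5ℚ * (b * b)) | ℚP.<-cmp 0ℚ a
  ... | tri< a²<5b² _ _ | _             = inj₂ (0<b , a²<5b²)
  ... | tri> _ _ 5b²<a² | tri< 0<a _ _  = inj₁ (0<a , 5b²<a²)
  ... | tri> _ _ 5b²<a² | tri≈ _ refl _ = contradiction 5b²<a² (ℚP.<-asym (0<* (ℚP.positive⁻¹ 5ℚ) (0<* 0<b 0<b)))
  ... | tri> _ _ _      | tri> _ _ a<0  = contradiction (ℚP.<-≤-trans a<0 0≤a) (ℚP.<-irrefl refl)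
  ... | tri≈ _ a²≡5b² _ | _ = contradiction
    (subst (λ x → x * x ≡ 5ℚ * (b * b)) (√5-irrational a b a²≡5b²) a²≡5b²)
    (ℚP.<⇒≢ (0<* (ℚP.positive⁻¹ 5ℚ) (0<* 0<b 0<b)))

  abs-Positive : ∀ x → Positive x → abs x ≡ x
  abs-Positive x p with positive? x
  ... | yes _ = refl
  ... | no ¬p = contradiction p ¬p

  abs-< : ∀ x {y} → x < y → fromℕ 0 ⊖ x < y → abs x ≤ y
  abs-< x x<y -x<y with positive? x
  ... | yes _ = inj₁ x<y
  ... | no  _ = inj₁ -x<y

  0≤-cancelˡ : ∀ {k x} → 0ℚ ℚ.< k → 0ℚ ℚ.≤ k * x → 0ℚ ℚ.≤ x
  0≤-cancelˡ {k} {x} 0<k 0≤kx = ℚP.*-cancelˡ-≤-pos k {{ℚ.positive 0<k}} (subst (ℚ._≤ k * x) (sym (ℚP.*-zeroʳ k)) 0≤kx)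

  -- Here ν, ω, σ and μ stand for n, W, S₁ and M, and E for the mean number of parts.
  module Limit
    {ε ν E ω σ μ : ℚ} (0<ε : 0ℚ ℚ.< ε) (0<ν : 0ℚ ℚ.< ν) (0<ω : 0ℚ ℚ.< ω) (0<μ : 0ℚ ℚ.< μ)
    (1≤με : 1ℚ ℚ.≤ μ * ε) (0≤σ : 0ℚ ℚ.≤ σ) (mean : (E - ν) * ω ≡ σ)
    (mean-≤ : 5ℚ * μ * (σ * σ) ℚ.≤ (μ + 1ℚ) * (ν * ν * (ω * ω)))
    (mean-≥ : 2ℚ * μ * (ν * ν * (ω * ω)) ℚ.≤ 10ℚ * μ * (σ * σ) + 3ℚ * (ν * ν * (ω * ω)))
    where
    -- This is the main term: (1 + √5) / (2 √5) · 2 ν = ν + ν / √5, and 1 / √5 = √5 / 5.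
    limit : ℚ√5
    limit = _+_√5 ν (⅕ * ν)

    private
      -- The mean of z, as a pair with z ones on either side has n + z parts; it has to be compared
      -- with ν / √5.
      D = E - ν

      0<μω² : 0ℚ ℚ.< μ * (ω * ω)
      0<μω² = 0<* 0<μ (0<* 0<ω 0<ω)
      -- Added once in `D-≤` and three times in `D-≥`, this exchanges the error 1 / μ for ε.
      0≤slack : 0ℚ ℚ.≤ (μ * ε - 1ℚ) * (ν * ν * (ω * ω))
      0≤slack = 0≤* (x≤y⇒0≤y-x 1≤με) (ℚP.<⇒≤ (0<* (0<* 0<ν 0<ν) (0<* 0<ω 0<ω)))

      0≤D : 0ℚ ℚ.≤ D
      0≤D = 0≤-cancelˡ 0<ω (subst (0ℚ ℚ.≤_) (trans (sym mean) (ℚP.*-comm D ω)) 0≤σ)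

      D-≤ : 0ℚ ℚ.≤ (1ℚ + ε) * (ν * ν) - 5ℚ * (D * D)
      D-≤ = 0≤-cancelˡ 0<μω² (subst (0ℚ ℚ.≤_)
        (trans (cong (λ s → (μ + 1ℚ) * (ν * ν * (ω * ω)) - 5ℚ * μ * (s * s) + (μ * ε - 1ℚ) * (ν * ν * (ω * ω))) (sym mean))
               (identity ε μ ν ω D))
        (0≤+ (x≤y⇒0≤y-x mean-≤) 0≤slack))
        where
        identity : ∀ ε μ ν ω D →
          (μ + 1ℚ) * (ν * ν * (ω * ω)) - 5ℚ * μ * (D * ω * (D * ω)) + (μ * ε - 1ℚ) * (ν * ν * (ω * ω)) ≡
          μ * (ω * ω) * ((1ℚ + ε) * (ν * ν) - 5ℚ * (D * D))
        identity = solve-∀ ℚ-ring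

      D-≥ : 0ℚ ℚ.≤ 10ℚ * (D * D) + 3ℚ * ε * (ν * ν) - 2ℚ * (ν * ν)
      D-≥ = 0≤-cancelˡ 0<μω² (subst (0ℚ ℚ.≤_)
        (trans (cong (λ s → 10ℚ * μ * (s * s) + 3ℚ * (ν * ν * (ω * ω)) - 2ℚ * μ * (ν * ν * (ω * ω))
                            + 3ℚ * ((μ * ε - 1ℚ) * (ν * ν * (ω * ω)))) (sym mean))
               (identity ε μ ν ω D))
        (0≤+ (x≤y⇒0≤y-x mean-≥) (0≤* (ℚP.nonNegative⁻¹ 3ℚ) 0≤slack)))
        where
        identity : ∀ ε μ ν ω D →
          10ℚ * μ * (D * ω * (D * ω)) + 3ℚ * (ν * ν * (ω * ω)) - 2ℚ * μ * (ν * ν * (ω * ω))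
            + 3ℚ * ((μ * ε - 1ℚ) * (ν * ν * (ω * ω))) ≡
          μ * (ω * ω) * (10ℚ * (D * D) + 3ℚ * ε * (ν * ν) - 2ℚ * (ν * ν))
        identity = solve-∀ ℚ-ring

      0<1+ε : 0ℚ ℚ.< 1ℚ + ε
      0<1+ε = 0<+ (ℚP.nonNegative⁻¹ 1ℚ) 0<ε
      0≤εν : 0ℚ ℚ.≤ ε * ν
      0≤εν = ℚP.<⇒≤ (0<* 0<ε 0<ν)

      limit-positive : Positive limit
      limit-positive = Positive-nonneg (ℚP.<⇒≤ 0<ν) (0<* (ℚP.positive⁻¹ ⅕) 0<ν)

      upper : fromℚ E ⊖ limit < fromℚ ε ⊗ limit
      upper = subst₂ (λ a b → Positive (_+_√5 a b)) (rational-part ε ν E) (irrational-part ε ν) positive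
        where
        rational-part : ∀ ε ν E → ε * ν - (E - ν) ≡ (ε * ν + 5ℚ * (0ℚ * (⅕ * ν))) - (E - ν)
        rational-part = solve-∀ ℚ-ring
        irrational-part : ∀ ε ν → ⅕ * (ν * (1ℚ + ε)) ≡ (ε * (⅕ * ν) + 0ℚ * ν) - (0ℚ - ⅕ * ν)
        irrational-part = solve-∀ ℚ-ring
        positive : Positive (_+_√5 (ε * ν - D) (⅕ * (ν * (1ℚ + ε))))
        positive with ℚP.≤-total D (ε * ν)
        ... | inj₁ D≤εν = Positive-nonneg (x≤y⇒0≤y-x D≤εν) (0<* (ℚP.positive⁻¹ ⅕) (0<* 0<ν 0<1+ε))
        -- Now 0 ≤ D - ε ν ≤ D, hence 5 (D - ε ν)² ≤ 5 D² ≤ (1 + ε) ν² < (1 + ε)² ν².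
        ... | inj₂ εν≤D = inj₂ (0<* (ℚP.positive⁻¹ ⅕) (0<* 0<ν 0<1+ε) , 0<y-x⇒x<y
          (subst (0ℚ ℚ.<_) (identity ε ν D) (0<* (ℚP.positive⁻¹ ⅕)
            (0<+ (0≤+ D-≤ (0≤* (ℚP.nonNegative⁻¹ 5ℚ)
                   (0≤* 0≤εν (0≤+ (x≤y⇒0≤y-x εν≤D) 0≤D))))
                 (0<* (0<* 0<ε 0<1+ε) (0<* 0<ν 0<ν))))))
          where
          identity : ∀ ε ν D →
            ⅕ * ((1ℚ + ε) * (ν * ν) - 5ℚ * (D * D) + 5ℚ * (ε * ν * (D - ε * ν + D)) + ε * (1ℚ + ε) * (ν * ν)) ≡
            5ℚ * (⅕ * (ν * (1ℚ + ε)) * (⅕ * (ν * (1ℚ + ε)))) - (ε * ν - D) * (ε * ν - D)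
          identity = solve-∀ ℚ-ring

      lower : fromℕ 0 ⊖ (fromℚ E ⊖ limit) < fromℚ ε ⊗ limit
      lower = subst₂ (λ a b → Positive (_+_√5 a b)) (rational-part ε ν E) (irrational-part ε ν) positive
        where
        rational-part : ∀ ε ν E → ε * ν + (E - ν) ≡ (ε * ν + 5ℚ * (0ℚ * (⅕ * ν))) - (0ℚ - (E - ν))
        rational-part = solve-∀ ℚ-ring
        irrational-part : ∀ ε ν → ⅕ * (ν * (ε - 1ℚ)) ≡ (ε * (⅕ * ν) + 0ℚ * ν) - (0ℚ - (0ℚ - ⅕ * ν))
        irrational-part = solve-∀ ℚ-ring
        positive : Positive (_+_√5 (ε * ν + D) (⅕ * (ν * (ε - 1ℚ))))
        -- The rational part dominates whatever the sign of ε - 1. In the difference of the squares,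
        -- (ε - 1)² contributes a gain of 2 ε ν² / 5, which outweighs the loss of 3 ε ν² / 10 from
        -- `D-≥` and leaves ε ν² / 10 for strictness.
        positive = inj₁ (ℚP.+-mono-<-≤ (0<* 0<ε 0<ν) 0≤D , 0<y-x⇒x<y
          (subst (0ℚ ℚ.<_) (identity ε ν D) (0<* (ℚP.positive⁻¹ ⅒)
            (0<+ (0≤+ (0≤+ D-≥ (0≤* (ℚP.nonNegative⁻¹ 8ℚ) (0≤* 0≤εν 0≤εν)))
                      (0≤* (ℚP.nonNegative⁻¹ 20ℚ) (0≤* 0≤εν 0≤D)))
                 (0<* 0<ε (0<* 0<ν 0<ν))))))
          where
          identity : ∀ ε ν D →
            ⅒ *
              (10ℚ * (D * D) + 3ℚ * ε * (ν * ν) - 2ℚ * (ν * ν)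
                + 8ℚ * (ε * ν * (ε * ν)) + 20ℚ * (ε * ν * D) + ε * (ν * ν)) ≡
            (ε * ν + D) * (ε * ν + D) - 5ℚ * (⅕ * (ν * (ε - 1ℚ)) * (⅕ * (ν * (ε - 1ℚ))))
          identity = solve-∀ ℚ-ring

    -- Stated for variables e and g: unfolding abs at the concrete sequences is computationally infeasible.
    close : ∀ {e g} → e ≡ E → g ≡ limit → abs (fromℚ e ⊖ g) ≤ fromℚ ε ⊗ abs g
    close refl refl = subst (λ g → abs (fromℚ E ⊖ limit) ≤ fromℚ ε ⊗ g) (sym (abs-Positive limit limit-positive))
      (abs-< (fromℚ E ⊖ limit) upper lower)

open QuadraticField

-- The mean number of parts in terms of the moments, and the asymptotic equivalence

module MeanNumberOfParts where
  open import Defs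
  open import Data.Rational using (_+_; _*_; _-_)
  open import Tactic.RingSolver using (solve-∀)
  import Data.Nat.Tactic.RingSolver as ℕS
  import Data.Integer.Tactic.RingSolver as ℤS

  length-cartesianProduct : ∀ {A B : Set} (xs : List A) (ys : List B) →
                            length (cartesianProduct xs ys) ≡ length xs ℕ.* length ys
  length-cartesianProduct []       ys = refl
  length-cartesianProduct (x ∷ xs) ys = trans (ListP.length-++ (map (x ,_) ys))
    (cong₂ ℕ._+_ (ListP.length-map (x ,_) ys) (length-cartesianProduct xs ys))

  module Counting where
    private
      -- The factor 1 is kept so that `total n 0` and `shifted n 0` are definitionally the moments
      -- `W` and `S₁` of the diagonal.
      total shifted : ℕ → ℕ → ℤ
      total a b   = ∑ (λ p → weight p ℤ.* ℤ.+ 1) (points a b)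
      shifted a b = ∑ (λ p → weight p ℤ.* ℤ.+ proj₁ p) (points a b)

      length-block : ∀ a b → length (block a b) ≡ binomial a b ℕ.* binomial a b
      length-block a b = trans (length-cartesianProduct (words a b) (words a b))
        (cong₂ ℕ._*_ (length-words a b) (length-words a b))

      parts-block : ∀ a b → sum (map parts (block a b)) ≡
                    binomial a b ℕ.* binomial a b ℕ.* ((a ℕ.+ 2 ℕ.* b) ℕ.+ a)
      parts-block a b = trans (sum-map-const parts (block a b) λ p∈ → constant (block-sound a b p∈))
        (cong (ℕ._* ((a ℕ.+ 2 ℕ.* b) ℕ.+ a)) (length-block a b))
        where
        arith : ∀ a b → (a ℕ.+ b) ℕ.+ (a ℕ.+ b) ≡ (a ℕ.+ 2 ℕ.* b) ℕ.+ a
        arith = ℕS.solve-∀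
        constant : ∀ {p} → BlockPair a b p → parts p ≡ (a ℕ.+ 2 ℕ.* b) ℕ.+ a
        constant (v , w) = trans (cong₂ ℕ._+_ (Word-length v) (Word-length w)) (arith a b)

      weight-block : ∀ a b → ℤ.+ length (block a b) ≡ weight (a , b) ℤ.* ℤ.+ 1
      weight-block a b = trans (cong ℤ.+_ (length-block a b)) (sym (ℤP.*-identityʳ _))

      weighted-parts-block : ∀ a b → ℤ.+ sum (map parts (block a b)) ≡
        ℤ.+ (a ℕ.+ 2 ℕ.* b) ℤ.* (weight (a , b) ℤ.* ℤ.+ 1) ℤ.+ weight (a , b) ℤ.* ℤ.+ a
      weighted-parts-block a b = trans (cong ℤ.+_ (parts-block a b))
        (trans (ℤP.pos-* (binomial a b ℕ.* binomial a b) ((a ℕ.+ 2 ℕ.* b) ℕ.+ a)) (arith (weight (a , b)) (ℤ.+ (a ℕ.+ 2 ℕ.* b)) (ℤ.+ a)))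
        where
        arith : ∀ w n a → w ℤ.* (n ℤ.+ a) ≡ n ℤ.* (w ℤ.* ℤ.+ 1) ℤ.+ w ℤ.* a
        arith = ℤS.solve-∀

    length-pairs : ∀ a b → ℤ.+ length (pairs a b) ≡ total a b
    length-pairs zero          b = trans (weight-block 0 b) (sym (ℤP.+-identityʳ (weight (0 , b) ℤ.* ℤ.+ 1)))
    length-pairs (suc zero)    b = trans (weight-block 1 b) (sym (ℤP.+-identityʳ (weight (1 , b) ℤ.* ℤ.+ 1)))
    length-pairs (suc (suc a)) b = trans (cong ℤ.+_ (ListP.length-++ (block (suc (suc a)) b)))
      (cong₂ ℤ._+_ (weight-block (suc (suc a)) b) (length-pairs a (suc b)))

    -- A pair in `block a b` has 2 (a + b) = (a + 2 b) + a parts, and a + 2 b is the same for all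
    -- blocks of a diagonal, so only the number of ones has to be averaged.
    sum-parts-pairs : ∀ a b → ℤ.+ sum (map parts (pairs a b)) ≡
                      ℤ.+ (a ℕ.+ 2 ℕ.* b) ℤ.* total a b ℤ.+ shifted a b
    sum-parts-pairs zero b = trans (weighted-parts-block 0 b)
      (sym (cong₂ ℤ._+_ (cong (λ t → ℤ.+ (2 ℕ.* b) ℤ.* t) (ℤP.+-identityʳ (weight (0 , b) ℤ.* ℤ.+ 1)))
                      (ℤP.+-identityʳ (weight (0 , b) ℤ.* ℤ.+ 0))))
    sum-parts-pairs (suc zero) b = trans (weighted-parts-block 1 b)
      (sym (cong₂ ℤ._+_ (cong (λ t → ℤ.+ (1 ℕ.+ 2 ℕ.* b) ℤ.* t) (ℤP.+-identityʳ (weight (1 , b) ℤ.* ℤ.+ 1)))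
                      (ℤP.+-identityʳ (weight (1 , b) ℤ.* ℤ.+ 1))))
    sum-parts-pairs (suc (suc a)) b = begin
      ℤ.+ sum (map parts (block a′ b ++ pairs a (suc b)))
        ≡⟨ cong ℤ.+_ (trans (cong sum (ListP.map-++ parts (block a′ b) _)) (sum-++ (map parts (block a′ b)) _)) ⟩
      ℤ.+ sum (map parts (block a′ b)) ℤ.+ ℤ.+ sum (map parts (pairs a (suc b)))
        ≡⟨ cong₂ ℤ._+_ (weighted-parts-block a′ b) (sum-parts-pairs a (suc b)) ⟩
      k ℤ.* t ℤ.+ s ℤ.+ (ℤ.+ (a ℕ.+ 2 ℕ.* suc b) ℤ.* total a (suc b) ℤ.+ shifted a (suc b))
        ≡⟨ cong (λ c → k ℤ.* t ℤ.+ s ℤ.+ (ℤ.+ c ℤ.* total a (suc b) ℤ.+ shifted a (suc b))) (+-2*suc a b) ⟩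
      k ℤ.* t ℤ.+ s ℤ.+ (k ℤ.* total a (suc b) ℤ.+ shifted a (suc b))
        ≡⟨ arith k t s (total a (suc b)) (shifted a (suc b)) ⟩
      k ℤ.* (t ℤ.+ total a (suc b)) ℤ.+ (s ℤ.+ shifted a (suc b)) ∎
      where
      open ≡-Reasoning
      a′ = suc (suc a)
      k = ℤ.+ (a′ ℕ.+ 2 ℕ.* b)
      t = weight (a′ , b) ℤ.* ℤ.+ 1
      s = weight (a′ , b) ℤ.* ℤ.+ a′
      arith : ∀ k t s t′ s′ → k ℤ.* t ℤ.+ s ℤ.+ (k ℤ.* t′ ℤ.+ s′) ≡ k ℤ.* (t ℤ.+ t′) ℤ.+ (s ℤ.+ s′)
      arith = ℤS.solve-∀

  fromℤ : ℤ → ℚ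
  fromℤ i = i ℚ./ 1

  fromℚᵘ-+ : ∀ p q → ℚ.fromℚᵘ (p ℚᵘ.+ q) ≡ ℚ.fromℚᵘ p + ℚ.fromℚᵘ q
  fromℚᵘ-+ p q = ℚP.toℚᵘ-injective (begin
    ℚ.toℚᵘ (ℚ.fromℚᵘ (p ℚᵘ.+ q))  ≈⟨ ℚP.toℚᵘ-fromℚᵘ (p ℚᵘ.+ q) ⟩
    p ℚᵘ.+ q  ≈⟨ ℚᵘP.+-cong (ℚP.toℚᵘ-fromℚᵘ p) (ℚP.toℚᵘ-fromℚᵘ q) ⟨
    ℚ.toℚᵘ (ℚ.fromℚᵘ p) ℚᵘ.+ ℚ.toℚᵘ (ℚ.fromℚᵘ q)  ≈⟨ ℚP.toℚᵘ-homo-+ (ℚ.fromℚᵘ p) (ℚ.fromℚᵘ q) ⟨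
    ℚ.toℚᵘ (ℚ.fromℚᵘ p + ℚ.fromℚᵘ q) ∎)
    where open import Relation.Binary.Reasoning.Setoid ℚᵘP.≃-setoid

  fromℚᵘ-* : ∀ p q → ℚ.fromℚᵘ (p ℚᵘ.* q) ≡ ℚ.fromℚᵘ p * ℚ.fromℚᵘ q
  fromℚᵘ-* p q = ℚP.toℚᵘ-injective (begin
    ℚ.toℚᵘ (ℚ.fromℚᵘ (p ℚᵘ.* q))  ≈⟨ ℚP.toℚᵘ-fromℚᵘ (p ℚᵘ.* q) ⟩
    p ℚᵘ.* q  ≈⟨ ℚᵘP.*-cong (ℚP.toℚᵘ-fromℚᵘ p) (ℚP.toℚᵘ-fromℚᵘ q) ⟨
    ℚ.toℚᵘ (ℚ.fromℚᵘ p) ℚᵘ.* ℚ.toℚᵘ (ℚ.fromℚᵘ q)  ≈⟨ ℚP.toℚᵘ-homo-* (ℚ.fromℚᵘ p) (ℚ.fromℚᵘ q) ⟨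
    ℚ.toℚᵘ (ℚ.fromℚᵘ p * ℚ.fromℚᵘ q) ∎)
    where open import Relation.Binary.Reasoning.Setoid ℚᵘP.≃-setoid

  fromℤ-+ : ∀ i j → fromℤ (i ℤ.+ j) ≡ fromℤ i + fromℤ j
  fromℤ-+ i j = trans (ℚP.fromℚᵘ-cong {ℚᵘ.mkℚᵘ (i ℤ.+ j) 0} {ℚᵘ.mkℚᵘ i 0 ℚᵘ.+ ℚᵘ.mkℚᵘ j 0} (ℚᵘ.*≡* (arith i j)))
    (fromℚᵘ-+ (ℚᵘ.mkℚᵘ i 0) (ℚᵘ.mkℚᵘ j 0))
    where
    arith : ∀ i j → (i ℤ.+ j) ℤ.* ℤ.+ 1 ≡ (i ℤ.* ℤ.+ 1 ℤ.+ j ℤ.* ℤ.+ 1) ℤ.* ℤ.+ 1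
    arith = ℤS.solve-∀

  fromℤ-* : ∀ i j → fromℤ (i ℤ.* j) ≡ fromℤ i * fromℤ j
  fromℤ-* i j = fromℚᵘ-* (ℚᵘ.mkℚᵘ i 0) (ℚᵘ.mkℚᵘ j 0)

  fromℤ-mono : ∀ {i j} → i ℤ.≤ j → fromℤ i ℚ.≤ fromℤ j
  fromℤ-mono {i} {j} i≤j = ℚP.toℚᵘ-cancel-≤
    (ℚᵘP.≤-respˡ-≃ (ℚᵘP.≃-sym (ℚP.toℚᵘ-fromℚᵘ (ℚᵘ.mkℚᵘ i 0)))
      (ℚᵘP.≤-respʳ-≃ (ℚᵘP.≃-sym (ℚP.toℚᵘ-fromℚᵘ (ℚᵘ.mkℚᵘ j 0)))
        (ℚᵘ.*≤* (ℤP.*-monoʳ-≤-nonNeg (ℤ.+ 1) i≤j))))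

  /-*-cancel : ∀ i l .{{_ : ℕ.NonZero l}} → (i ℚ./ l) * fromℤ (ℤ.+ l) ≡ fromℤ i
  /-*-cancel i (suc l) = trans (sym (fromℚᵘ-* (ℚᵘ.mkℚᵘ i l) (ℚᵘ.mkℚᵘ (ℤ.+ suc l) 0)))
    (ℚP.fromℚᵘ-cong {ℚᵘ.mkℚᵘ i l ℚᵘ.* ℚᵘ.mkℚᵘ (ℤ.+ suc l) 0} {ℚᵘ.mkℚᵘ i 0}
      (ℚᵘ.*≡* (trans (arith i (ℤ.+ suc l)) (cong (i ℤ.*_) (sym (cong ℤ.+_ (ℕP.*-identityʳ (suc l))))))))
    where
    arith : ∀ i k → i ℤ.* k ℤ.* ℤ.+ 1 ≡ i ℤ.* k
    arith = ℤS.solve-∀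

  expectedParts-*-total : ∀ n → let xs = Enumeration.elements (compositionPairs n) in
    expectedParts n * fromℤ (ℤ.+ length xs) ≡ fromℤ (ℤ.+ sum (map parts xs))
  expectedParts-*-total n = /-*-cancel (ℤ.+ sum (map parts elements)) (length elements) {{nonZero}}
    where open Enumeration (compositionPairs n)

  module MeanParts (n : ℕ) (1≤n : 1 ℕ.≤ n) where
    open Diagonal n 1≤n
    open Enumeration (compositionPairs n) using (elements; nonZero)

    length≡W : ℤ.+ length elements ≡ W
    length≡W = trans (cong ℤ.+_ (↭P.↭-length (compositionPairs-↭ n))) (Counting.length-pairs n 0)

    parts≡ : ℤ.+ sum (map parts elements) ≡ ℤ.+ n ℤ.* W ℤ.+ S₁
    parts≡ = trans (cong ℤ.+_ (sum-↭ (↭P.map⁺ parts (compositionPairs-↭ n))))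
      (trans (Counting.sum-parts-pairs n 0) (cong (λ k → ℤ.+ k ℤ.* W ℤ.+ S₁) (ℕP.+-identityʳ n)))

    1≤W : ℤ.+ 1 ℤ.≤ W
    1≤W = subst (ℤ.+ 1 ℤ.≤_) length≡W (ℤ.+≤+ (ℕ.>-nonZero⁻¹ (length elements) {{nonZero}}))

    0≤S₁ : ℤ.+ 0 ℤ.≤ S₁
    0≤S₁ = 𝔼-nonneg λ 0≤z → 0≤z

    ν ω σ : ℚ
    ν = fromℤ (ℤ.+ n)
    ω = fromℤ W
    σ = fromℤ S₁

    0<ν : 0ℚ ℚ.< ν
    0<ν = ℚP.<-≤-trans (ℚP.positive⁻¹ 1ℚ) (fromℤ-mono (ℤ.+≤+ 1≤n))

    0<ω : 0ℚ ℚ.< ω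
    0<ω = ℚP.<-≤-trans (ℚP.positive⁻¹ 1ℚ) (fromℤ-mono 1≤W)

    mean : (expectedParts n - ν) * ω ≡ σ
    mean = begin
      (expectedParts n - ν) * ω
        ≡⟨ arith (expectedParts n) ν ω ⟩
      expectedParts n * ω - ν * ω
        ≡⟨ cong (λ w → expectedParts n * fromℤ w - ν * ω) length≡W ⟨
      expectedParts n * fromℤ (ℤ.+ length elements) - ν * ω
        ≡⟨ cong (_- ν * ω) (trans (expectedParts-*-total n) (cong fromℤ parts≡)) ⟩
      fromℤ (ℤ.+ n ℤ.* W ℤ.+ S₁) - ν * ω
        ≡⟨ cong (_- ν * ω) (trans (fromℤ-+ (ℤ.+ n ℤ.* W) S₁) (cong (_+ σ) (fromℤ-* (ℤ.+ n) W))) ⟩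
      ν * ω + σ - ν * ω
        ≡⟨ arith′ (ν * ω) σ ⟩
      σ ∎
      where
      open ≡-Reasoning
      arith : ∀ e v w → (e - v) * w ≡ e * w - v * w
      arith = solve-∀ ℚ-ring
      arith′ : ∀ x s → x + s - x ≡ s
      arith′ = solve-∀ ℚ-ring

    0≤σ : 0ℚ ℚ.≤ σ
    0≤σ = fromℤ-mono 0≤S₁

    module _ (M : ℕ) (large : 6400 ℕ.* (M ℕ.* M) ℕ.≤ n) where
      private
        M-small : ℤ.+ 6400 ℤ.* sq (ℤ.+ M) ℤ.≤ ℤ.+ n
        M-small = subst (ℤ._≤ ℤ.+ n)
          (trans (ℤP.pos-* 6400 (M ℕ.* M)) (cong (ℤ.+ 6400 ℤ.*_) (ℤP.pos-* M M))) (ℤ.+≤+ large)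

        open Concentration {ℤ.+ n} {ℤ.+ M} {W} {S₁} {S₂} {U₂} (ℤ.+≤+ 1≤n) (0≤pos M) 1≤W fourth M-small
          (second-moment-≤ (ℤ.+ M)) (second-moment-≥ (ℤ.+ M)) (variance-≤ (ℤ.+ M)) variance-nonneg

        μ : ℚ
        μ = fromℤ (ℤ.+ M)

        fromℤ-sq : ∀ i → fromℤ (sq i) ≡ fromℤ i * fromℤ i
        fromℤ-sq i = fromℤ-* i i

        fromℤ-sq*sq : ∀ i j → fromℤ (sq i ℤ.* sq j) ≡ fromℤ i * fromℤ i * (fromℤ j * fromℤ j)
        fromℤ-sq*sq i j = trans (fromℤ-* (sq i) (sq j)) (cong₂ _*_ (fromℤ-sq i) (fromℤ-sq j))

        fromℤ-*₂ : ∀ k i j → fromℤ (k ℤ.* i ℤ.* j) ≡ fromℤ k * fromℤ i * fromℤ j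
        fromℤ-*₂ k i j = trans (fromℤ-* (k ℤ.* i) j) (cong (_* fromℤ j) (fromℤ-* k i))

      mean-≤ᵠ : fromℤ (ℤ.+ 5) * μ * (σ * σ) ℚ.≤ (μ + 1ℚ) * (ν * ν * (ω * ω))
      mean-≤ᵠ = subst₂ ℚ._≤_
        (trans (fromℤ-*₂ (ℤ.+ 5) (ℤ.+ M) (sq S₁)) (cong (fromℤ (ℤ.+ 5) * μ *_) (fromℤ-sq S₁)))
        (trans (fromℤ-* (ℤ.+ M ℤ.+ ℤ.+ 1) (sq (ℤ.+ n) ℤ.* sq W))
          (cong₂ _*_ (fromℤ-+ (ℤ.+ M) (ℤ.+ 1)) (fromℤ-sq*sq (ℤ.+ n) W)))
        (fromℤ-mono mean-≤)

      mean-≥ᵠ : fromℤ (ℤ.+ 2) * μ * (ν * ν * (ω * ω)) ℚ.≤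
                fromℤ (ℤ.+ 10) * μ * (σ * σ) + fromℤ (ℤ.+ 3) * (ν * ν * (ω * ω))
      mean-≥ᵠ = subst₂ ℚ._≤_
        (trans (fromℤ-*₂ (ℤ.+ 2) (ℤ.+ M) (sq (ℤ.+ n) ℤ.* sq W)) (cong (fromℤ (ℤ.+ 2) * μ *_) (fromℤ-sq*sq (ℤ.+ n) W)))
        (trans (fromℤ-+ (ℤ.+ 10 ℤ.* ℤ.+ M ℤ.* sq S₁) (ℤ.+ 3 ℤ.* (sq (ℤ.+ n) ℤ.* sq W)))
          (cong₂ _+_
            (trans (fromℤ-*₂ (ℤ.+ 10) (ℤ.+ M) (sq S₁)) (cong (fromℤ (ℤ.+ 10) * μ *_) (fromℤ-sq S₁)))
            (trans (fromℤ-* (ℤ.+ 3) (sq (ℤ.+ n) ℤ.* sq W)) (cong (fromℤ (ℤ.+ 3) *_) (fromℤ-sq*sq (ℤ.+ n) W)))))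
        (fromℤ-mono mean-≥)

  coefficient : ℚ√5
  coefficient = _+_√5 ((ℤ.+ 1) ℚ./ 2) ((ℤ.+ 1) ℚ./ 10)

  coefficient≡ : (fromℕ 1 ⊕ √5) ⊘ (fromℕ 2 ⊗ √5) ≡ coefficient
  coefficient≡ = refl

  main-term≡ : ∀ n → ((fromℕ 1 ⊕ √5) ⊘ (fromℕ 2 ⊗ √5)) ⊗ fromℕ (2 ℕ.* n) ≡ _+_√5 (fromℤ (ℤ.+ n)) (⅕ * fromℤ (ℤ.+ n))
  main-term≡ n = begin
    ((fromℕ 1 ⊕ √5) ⊘ (fromℕ 2 ⊗ √5)) ⊗ fromℕ (2 ℕ.* n)
      ≡⟨ cong (λ c → c ⊗ fromℕ (2 ℕ.* n)) coefficient≡ ⟩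
    coefficient ⊗ fromℕ (2 ℕ.* n)
      ≡⟨ cong (λ q → coefficient ⊗ fromℚ q) (trans (cong fromℤ (ℤP.pos-* 2 n)) (fromℤ-* (ℤ.+ 2) (ℤ.+ n))) ⟩
    coefficient ⊗ fromℚ (fromℤ (ℤ.+ 2) * fromℤ (ℤ.+ n))
      ≡⟨ cong₂ _+_√5 (rational-part (fromℤ (ℤ.+ n))) (irrational-part (fromℤ (ℤ.+ n))) ⟩
    _+_√5 (fromℤ (ℤ.+ n)) (⅕ * fromℤ (ℤ.+ n)) ∎
    where
    open ≡-Reasoning
    rational-part : ∀ ν → ((ℤ.+ 1) ℚ./ 2) * (((ℤ.+ 2) ℚ./ 1) * ν) + ((ℤ.+ 5) ℚ./ 1) * (((ℤ.+ 1) ℚ./ 10) * 0ℚ) ≡ ν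
    rational-part = solve-∀ ℚ-ring
    irrational-part : ∀ ν → ((ℤ.+ 1) ℚ./ 2) * 0ℚ + ((ℤ.+ 1) ℚ./ 10) * (((ℤ.+ 2) ℚ./ 1) * ν) ≡ ⅕ * ν
    irrational-part = solve-∀ ℚ-ring

  -- The product is the numerator of ε, a positive integer.
  denominator-*-≥1 : ∀ {ε} → 0ℚ ℚ.< ε → 1ℚ ℚ.≤ fromℤ (ℤ.+ ℚ.↧ₙ ε) * ε
  denominator-*-≥1 {ε@record{}} 0<ε = subst (1ℚ ℚ.≤_)
    (trans (sym (/-*-cancel (ℚ.↥ ε) (ℚ.↧ₙ ε)))
      (trans (cong (_* fromℤ (ℤ.+ ℚ.↧ₙ ε)) (ℚP.↥p/↧p≡p ε)) (ℚP.*-comm ε (fromℤ (ℤ.+ ℚ.↧ₙ ε)))))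
    (fromℤ-mono (ℤP.i<j⇒suc[i]≤j (ℤP.positive⁻¹ (ℚ.↥ ε) {{ℚ.positive 0<ε}})))

  mean-close : ∀ {ε} M n → 0ℚ ℚ.< ε → 0ℚ ℚ.< fromℤ (ℤ.+ M) → 1ℚ ℚ.≤ fromℤ (ℤ.+ M) * ε →
    1 ℕ.≤ n → 6400 ℕ.* (M ℕ.* M) ℕ.≤ n →
    abs (fromℚ (expectedSteps n) ⊖ ((fromℕ 1 ⊕ √5) ⊘ (fromℕ 2 ⊗ √5)) ⊗ fromℕ (2 ℕ.* n))
      ≤ fromℚ ε ⊗ abs (((fromℕ 1 ⊕ √5) ⊘ (fromℕ 2 ⊗ √5)) ⊗ fromℕ (2 ℕ.* n))
  mean-close {ε} M n 0<ε 0<μ 1≤με 1≤n large =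
    Limit.close {ε} {ν} {expectedParts n} {ω} {σ} {fromℤ (ℤ.+ M)} 0<ε 0<ν 0<ω 0<μ 1≤με 0≤σ mean
      (mean-≤ᵠ M large) (mean-≥ᵠ M large) {expectedSteps n} {((fromℕ 1 ⊕ √5) ⊘ (fromℕ 2 ⊗ √5)) ⊗ fromℕ (2 ℕ.* n)} (expectedSteps≡expectedParts n) (main-term≡ n)
    where open MeanParts n 1≤n

open MeanNumberOfParts

open import Defs
open import Data.Nat using (ℕ; _*_)
open import Data.Product using (_×_)
open import Relation.Binary.PropositionalEquality using (_≡_)

theorem3p4 : ((λ n → fromℚ (expectedSteps n))
    ∼ (λ n → ((fromℕ 1 ⊕ √5) ⊘ (fromℕ 2 ⊗ √5)) ⊗ fromℕ (2 * n)))
    × (∀ (n : ℕ) → expectedSteps n ≡ expectedParts n)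
theorem3p4 = asymptotics , expectedSteps≡expectedParts
  where
  asymptotics : (λ n → fromℚ (expectedSteps n)) ∼ (λ n → ((fromℕ 1 ⊕ √5) ⊘ (fromℕ 2 ⊗ √5)) ⊗ fromℕ (2 * n))
  -- 6400 M² is the threshold of `Concentration`, with M the denominator of ε, so that 1 / M ≤ ε.
  -- The successor also provides 1 ≤ n.
  asymptotics ε 0<ε = suc (6400 * (M * M)) , λ n n₀≤n →
    mean-close M n 0<ε 0<μ (denominator-*-≥1 0<ε) (ℕP.≤-trans (ℕ.s≤s ℕ.z≤n) n₀≤n) (ℕP.<⇒≤ n₀≤n)
    where
    M = ℚ.↧ₙ ε
    0<μ : 0ℚ ℚ.< fromℤ (ℤ.+ M)
    0<μ = ℚP.<-≤-trans (ℚP.positive⁻¹ 1ℚ) (fromℤ-mono {ℤ.+ 1} {ℤ.+ M} (ℤ.+≤+ (ℕ.s≤s ℕ.z≤n)))
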